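{- Let $A$ be a set of actions. The rule $\mathrm{RSP}^*$ is a derivable rule in $\mathsf{cMil}$.
   Context: **Star expressions.** For a set $A$ of actions, the set $StExp(A)$ of star expressions is generated by $e ::= 0\mid 1\mid a\mid (e_1+e_2)\mid (e_1\cdot e_2)\mid e^*$ with $a\in A$. $\sum_{i=1}^n e_i$ is $0$ for $n=0$, $e_1$ for $n=1$, and $(\sum_{i=1}^{n-1}e_i)+e_n$ for $n>1$. $Eq(A)$ is the set of formal equations $e=f$ with $e,f\in StExp(A)$. Immediate termination $e{\downarrow}$ is defined inductively by: $1{\downarrow}$; $(e_1+e_2){\downarrow}$ if $e_1{\downarrow}$ or $e_2{\downarrow}$; $(e_1\cdot e_2){\downarrow}$ if $e_1{\downarrow}$ and $e_2{\downarrow}$; $(e^*){\downarrow}$ always. Write $e{\not\downarrow}$ if $e{\downarrow}$ does not hold. **Proof systems.** An $Eq(A)$-based proof system is a Hilbert-style proof system whose formulas are the equations in $Eq(A)$; $e=_S f$ means that $e=f$ is derivable in $S$ without assumptions. It is $\mathcal{EL}$-based if its rules include those of equational logic: reflexivity, symmetry, transitivity, and the context rule (from $e=f$ infer $C[e]=C[f]$ for one-hole star expression contexts $C$). $S+\Gamma$ adds the equations in $\Gamma\subseteq Eq(A)$ as axioms to $S$. A rule $R$ is derivable in $S$ if for every instance $\iota$ of $R$ there is a derivation in $S$ whose assumptions are contained in the set of premises of $\iota$ and whose conclusion is the conclusion of $\iota$. $\mathsf{ACI}$ consists of the axioms $(e+f)+g=e+(f+g)$, $e+f=f+e$, $e+e=e$;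 $\mathsf{ACI}\sqsubseteq S$ means that all of these are axioms of $S$. $\mathrm{RSP}^*$ is the rule: from $e=f\cdot e+g$ infer $e=f^*\cdot g$, provided $f{\not\downarrow}$ (for $e,f,g\in StExp(A)$). $\mathsf{Mil}^-$ is the $\mathcal{EL}$-based system with exactly the rules of equational logic and the axiom schemes: $(e+f)+g=e+(f+g)$, $e+0=e$, $e+f=f+e$, $e+e=e$, $(e\cdot f)\cdot g=e\cdot(f\cdot g)$, $(e+f)\cdot g=e\cdot g+f\cdot g$, $1\cdot e=e$, $e\cdot 1=e$, $0\cdot e=0$, $e^*=1+e\cdot e^*$, $e^*=(1+e)^*$. **1-charts and solutions.** A 1-chart is $C=\langle V,A,1,v_s,\to,\downarrow\rangle$ with a finite set $V$ of vertices, a set $A$ of (proper) action labels, an empty-step label $1\notin A$, a start vertex $v_s\in V$, a transition relation $\to\,\subseteq V\times(A\cup\{1\})\times V$, and a set $\downarrow\,\subseteq V$ of vertices with immediate termination. Transitions with label in $A$ are proper; those with label $1$ are 1-transitions. $C$ is weakly guarded if it has no cycle of 1-transitions. For an $\mathcal{EL}$-based system $S$ with $\mathsf{ACI}\sqsubseteq S$, a function $s:V\to StExp(A)$ is an $S$-provable solution of $C$ if for every $v\in V$: $s(v)=_S\tau_C(v)+\sum_{i=1}^n\underline a_i\cdot s(v_i)$, where $v\xrightarrow{\underline a_i}v_i$ ($1\le i\le n$, $\underline a_i\in A\cup\{1\}$) is a (possibly redundant) list of all transitions from $v$, and $\tau_C(v)$ is $1$ if $v{\downarrow}$ and $0$ otherwise.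 **Guarded LLEE-1-charts.** A loop 1-chart is a 1-chart such that (L1) there is an infinite path from the start vertex, (L2) every infinite path from the start vertex returns to it after a positive number of transitions, (L3) immediate termination is only permitted at the start vertex. Its transitions from the start vertex are its loop-entry transitions, all other transitions belong to its body. A loop sub-1-chart of $C$ is a loop 1-chart $L$ that is a sub-1-chart of $C$ with some vertex $v$ of $C$ as start vertex, formed, for a nonempty set $U$ of transitions of $C$ from $v$ (the loop-entry transitions of $L$), by all vertices and transitions on paths that start with a transition in $U$ and continue onward until $v$ is reached again. A multi-step loop elimination of loop sub-1-charts $L_1,\dots,L_n$ ($n\ge1$) from $C$, where their sets of loop-entry transitions are pairwise disjoint and no start vertex of one is in the body of another one, removes all loop-entry transitions of $L_1,\dots,L_n$, and then all vertices and transitions that become unreachable. A run (sequence of multi-steps) from $C$ is successful if it leads to a 1-chart without an infinite path; it is layered if it never removes loop-entry transitions that depart from a vertex in the body of a previously eliminated loop sub-1-chart. A LLEE-witness of $C$ is the labeling of the transitions of $C$ by natural numbers that records a successful layered run: marking label $n\ge1$ for transitions removed as loop-entry transitions in the $n$-th multi-step ('loop-entry transitions'), label $0$ for all other transitions ('body transitions'). It is guarded if all of its loop-entry transitions are proper. A guarded LLEE-1-chart is a 1-chart that has a guarded LLEE-witness. **Coinductive proofs.** Let $S$ be $\mathcal{EL}$-based with $\mathsf{ACI}\sqsubseteq S$. A coinductive proof over $S$ of $e_1=e_2$ is a pair $\langle C,L\rangle$ of a weakly guarded 1-chart $C$ with start vertex $v_s$ and a function $L:V(C)\to Eq(A)$,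 $v\mapsto (L_1(v)=L_2(v))$, such that $L_1$ and $L_2$ are $S$-provable solutions of $C$ and $L_1(v_s)\equiv e_1$, $L_2(v_s)\equiv e_2$ (syntactic equality). It is LLEE-witnessed if $C$ is a guarded LLEE-1-chart. $e_1\overset{\mathrm{LLEE}}{=}_S e_2$ means that there is a LLEE-witnessed coinductive proof over $S$ of $e_1=e_2$. **The system $\mathsf{cMil}$.** For $n\in\mathbb N$ (including $0$), the rule $\mathrm{LCoProof}_n$ permits to infer $e=f$ from premises $g_1=h_1,\dots,g_n=h_n$ provided $e\overset{\mathrm{LLEE}}{=}_{\mathsf{Mil}^-+\Gamma}f$ for $\Gamma=\{g_1=h_1,\dots,g_n=h_n\}$. $\mathsf{cMil}$ is $\mathsf{Mil}^-$ extended by all rules $\mathrm{LCoProof}_n$, $n\in\mathbb N$. -}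

module Defs where

open import Data.Bool.Base using (if_then_else_)
open import Data.Empty using (⊥)
open import Data.Fin.Base using (Fin)
open import Data.List.Base using (List; []; _∷_; length; foldl; map)
open import Data.List.Membership.Propositional using (_∈_)
open import Data.List.Relation.Unary.All using (All)
open import Data.Nat.Base using (ℕ; zero; suc; _≤_)
open import Data.Product.Base using (Σ; ∃; ∃₂; _×_; _,_; proj₁; proj₂)
open import Data.Sum.Base using (_⊎_; inj₁; inj₂)
open import Data.Unit.Base using (⊤; tt)
open import Function.Base using (_∘_)
open import Function.Bundles using (_↔_; _⇔_)
open import Level using (Level; 0ℓ) renaming (suc to lsuc; _⊔_ to _⊔ˡ_)
open import Relation.Binary.Construct.Closure.ReflexiveTransitive using (Star; ε; _◅_; _◅◅_)
open import Relation.Binary.Construct.Closure.Transitive using (TransClosure)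
open import Relation.Binary.Construct.Union using (_∪_)
open import Relation.Binary.Core using (REL)
open import Relation.Binary.PropositionalEquality using (_≡_; _≢_; refl)
open import Relation.Nullary.Decidable.Core using (does)
open import Relation.Nullary.Negation.Core using (¬_)
open import Relation.Unary using (Pred; Decidable; ∅)

------------------------------------------------------------------------
-- Star expressions

infix  6 _≐_
infixl 7 _+_
infixl 8 _·_
infix  9 _⋆

data StExp (A : Set) : Set where
  𝟘 𝟙     : StExp A
  act     : A → StExp A
  _+_ _·_ : StExp A → StExp A → StExp A
  _⋆      : StExp A → StExp A

-- ∑ (e₁ ∷ … ∷ eₙ ∷ []) is ((e₁ + e₂) + …) + eₙ, without a leading 𝟘.
∑ : ∀ {A} → List (StExp A) → StExp A
∑ []       = 𝟘
∑ (e ∷ es) = foldl _+_ e es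

data Eq (A : Set) : Set where
  _≐_ : StExp A → StExp A → Eq A

lhs rhs : ∀ {A} → Eq A → StExp A
lhs (e ≐ f) = e
rhs (e ≐ f) = f

infix 4 _↓

data _↓ {A : Set} : StExp A → Set where
  𝟙↓  : 𝟙 ↓
  +↓ˡ : ∀ {e₁ e₂} → e₁ ↓ → e₁ + e₂ ↓
  +↓ʳ : ∀ {e₁ e₂} → e₂ ↓ → e₁ + e₂ ↓
  ·↓  : ∀ {e₁ e₂} → e₁ ↓ → e₂ ↓ → e₁ · e₂ ↓
  ⋆↓  : ∀ {e} → e ⋆ ↓

data Context (A : Set) : Set where
  □       : Context A
  _+ˡ_    : Context A → StExp A → Context A
  _+ʳ_    : StExp A → Context A → Context A
  _·ˡ_    : Context A → StExp A → Context A
  _·ʳ_    : StExp A → Context A → Context A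
  _⋆□     : Context A → Context A

_[_] : ∀ {A} → Context A → StExp A → StExp A
□        [ e ] = e
(C +ˡ f) [ e ] = C [ e ] + f
(f +ʳ C) [ e ] = f + C [ e ]
(C ·ˡ f) [ e ] = C [ e ] · f
(f ·ʳ C) [ e ] = f · C [ e ]
(C ⋆□)   [ e ] = (C [ e ]) ⋆

------------------------------------------------------------------------
-- Hilbert-style proof systems over equations

-- A rule is given by its instances: it relates lists of premises to
-- conclusions.  A proof system is the union of its rules (an axiom being
-- a rule instance without premises), so it has the same type.
Rule ProofSystem : Set → (ℓ : Level) → Set (lsuc ℓ)
Rule        A ℓ = REL (List (Eq A)) (Eq A) ℓ
ProofSystem A ℓ = Rule A ℓ

-- S ∣ Δ ⊢ E : there is a derivation in S of E from assumptions in Δ.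
infix 3 _∣_⊢_
data _∣_⊢_ {A : Set} {ℓ ℓ′} (S : ProofSystem A ℓ) (Δ : Pred (Eq A) ℓ′) :
           Eq A → Set (ℓ ⊔ˡ ℓ′) where
  assumption : ∀ {E} → Δ E → S ∣ Δ ⊢ E
  infer      : ∀ {Es E} → S Es E → All (S ∣ Δ ⊢_) Es → S ∣ Δ ⊢ E

infix 3 _⊢_
_⊢_ : ∀ {A ℓ} → ProofSystem A ℓ → Eq A → Set ℓ
S ⊢ E = S ∣ ∅ ⊢ E

DerivableIn : ∀ {A ℓ ℓ′} → ProofSystem A ℓ → Rule A ℓ′ → Set (ℓ ⊔ˡ ℓ′)
DerivableIn S R = ∀ {Es E} → R Es E → S ∣ (_∈ Es) ⊢ E

data Axioms {A : Set} {ℓ} (Γ : Pred (Eq A) ℓ) : Rule A ℓ where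
  axiom : ∀ {E} → Γ E → Axioms Γ [] E

infixl 5 _⊞_
_⊞_ : ∀ {A ℓ ℓ′} → ProofSystem A ℓ → Pred (Eq A) ℓ′ → ProofSystem A (ℓ ⊔ˡ ℓ′)
S ⊞ Γ = S ∪ Axioms Γ

data EL {A : Set} : Rule A 0ℓ where
  reflexivity  : ∀ {e}     → EL [] (e ≐ e)
  symmetry     : ∀ {e f}   → EL (e ≐ f ∷ []) (f ≐ e)
  transitivity : ∀ {e f g} → EL (e ≐ f ∷ f ≐ g ∷ []) (e ≐ g)
  context      : ∀ {e f} C → EL (e ≐ f ∷ []) (C [ e ] ≐ C [ f ])

data Mil⁻-Axiom {A : Set} : Pred (Eq A) 0ℓ where
  +-assoc     : ∀ {e f g} → Mil⁻-Axiom ((e + f) + g ≐ e + (f + g))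
  +-identity  : ∀ {e}     → Mil⁻-Axiom (e + 𝟘 ≐ e)
  +-comm      : ∀ {e f}   → Mil⁻-Axiom (e + f ≐ f + e)
  +-idem      : ∀ {e}     → Mil⁻-Axiom (e + e ≐ e)
  ·-assoc     : ∀ {e f g} → Mil⁻-Axiom ((e · f) · g ≐ e · (f · g))
  ·-distribʳ  : ∀ {e f g} → Mil⁻-Axiom ((e + f) · g ≐ e · g + f · g)
  ·-identityˡ : ∀ {e}     → Mil⁻-Axiom (𝟙 · e ≐ e)
  ·-identityʳ : ∀ {e}     → Mil⁻-Axiom (e · 𝟙 ≐ e)
  ·-zeroˡ     : ∀ {e}     → Mil⁻-Axiom (𝟘 · e ≐ 𝟘)
  ⋆-unfold    : ∀ {e}     → Mil⁻-Axiom (e ⋆ ≐ 𝟙 + e · e ⋆)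
  ⋆-𝟙+        : ∀ {e}     → Mil⁻-Axiom (e ⋆ ≐ (𝟙 + e) ⋆)

Mil⁻ : ∀ {A} → ProofSystem A 0ℓ
Mil⁻ = EL ∪ Axioms Mil⁻-Axiom

data RSP⋆ {A : Set} : Rule A 0ℓ where
  rsp⋆ : ∀ {e f g} → ¬ (f ↓) → RSP⋆ (e ≐ f · e + g ∷ []) (e ≐ f ⋆ · g)

------------------------------------------------------------------------
-- 1-charts

data Label (A : Set) : Set where
  proper : A → Label A
  one    : Label A

⟦_⟧ : ∀ {A} → Label A → StExp A
⟦ proper a ⟧ = act a
⟦ one ⟧      = 𝟙

Transitions : Set → Set → Set₁
Transitions A V = V → Label A → V → Set

-- Only inhabitation of v —[ a ]→ w and of Terminates v is ever used, so
-- they represent subsets of V × Label A × V and of V.  Membership in the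
-- latter is decidable because τ is defined by a case distinction on it.
record 1-Chart (A : Set) : Set₁ where
  field
    V           : Set
    V-finite    : ∃ λ n → V ↔ Fin n
    start       : V
    _—[_]→_     : Transitions A V
    Terminates  : Pred V 0ℓ
    terminates? : Decidable Terminates

  τ : V → StExp A
  τ v = if does (terminates? v) then 𝟙 else 𝟘

  -- The list may be redundant.
  ListsTransitionsFrom : V → List (Label A × V) → Set
  ListsTransitionsFrom v ts = ∀ a w → v —[ a ]→ w ⇔ (a , w) ∈ ts

  WeaklyGuarded : Set
  WeaklyGuarded = ¬ ∃ λ v → TransClosure (λ u w → u —[ one ]→ w) v v

-- Meant for systems S that contain EL and the axioms +-assoc, +-comm and
-- +-idem; then the order and multiplicity in ts are immaterial.
IsSolution : ∀ {A ℓ} → ProofSystem A ℓ → (C : 1-Chart A) → (1-Chart.V C → StExp A) → Set ℓ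
IsSolution S C s = ∀ v → ∃ λ ts → ListsTransitionsFrom v ts ×
    (S ⊢ s v ≐ τ v + ∑ (map (λ (a , w) → ⟦ a ⟧ · s w) ts))
  where open 1-Chart C

------------------------------------------------------------------------
-- Loop elimination

Step : ∀ {A V} → Transitions A V → V → V → Set
Step T u w = ∃ λ a → T u a w

InfinitePath : ∀ {A V} → Transitions A V → (ℕ → V) → Set
InfinitePath T π = ∀ i → Step T (π i) (π (suc i))

module LoopElimination {A : Set} (C : 1-Chart A) where
  open 1-Chart C using (V; Terminates) renaming (start to start₀; _—[_]→_ to _—[_]→₀_)

  -- Sub-1-charts inherit immediate termination from C.
  record Sub1Chart : Set₁ where
    field
      Vertex  : Pred V 0ℓ
      start   : V
      start∈  : Vertex start
      _—[_]→_ : Transitions A V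
      →⊆      : ∀ {u a w} → u —[ a ]→ w → u —[ a ]→₀ w
      source∈ : ∀ {u a w} → u —[ a ]→ w → Vertex u
      target∈ : ∀ {u a w} → u —[ a ]→ w → Vertex w

    HasInfinitePath : Set
    HasInfinitePath = ∃ (InfinitePath _—[_]→_)

  open Sub1Chart using (start)

  whole : Sub1Chart
  whole = record
    { Vertex  = λ _ → ⊤
    ; start   = start₀
    ; _—[_]→_ = _—[_]→₀_
    ; →⊆      = λ t → t
    }

  record IsLoop (L : Sub1Chart) : Set where
    open Sub1Chart L using (Vertex; _—[_]→_)
    field
      L1 : ∃ λ π → InfinitePath _—[_]→_ π × π 0 ≡ start L
      L2 : ∀ π → InfinitePath _—[_]→_ π → π 0 ≡ start L →
           ∃ λ k → 1 ≤ k × π k ≡ start L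
      L3 : ∀ {w} → Vertex w → Terminates w → w ≡ start L

  InBody : Sub1Chart → Pred V 0ℓ
  InBody L w = Sub1Chart.Vertex L w × w ≢ start L

  -- The sub-1-chart of K formed by all paths that start with a transition
  -- v —[ a ]→ w such that U a w, and that continue onward in K until v is
  -- reached again (if ever).
  module Generate (K : Sub1Chart) (v : V) (U : Label A → V → Set)
                  (U⊆ : ∀ {a w} → U a w → Sub1Chart._—[_]→_ K v a w) where
    open Sub1Chart K

    data Reached : Pred V 0ℓ where
      enter  : ∀ {a w} → U a w → Reached w
      onward : ∀ {u a w} → Reached u → u ≢ v → u —[ a ]→ w → Reached w

    Entry Inner : Transitions A V
    Entry u a w = u ≡ v × U a w
    Inner u a w = Reached u × u ≢ v × u —[ a ]→ w

    generated : Sub1Chart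
    generated = record
      { Vertex  = λ w → w ≡ v ⊎ Reached w
      ; start   = v
      ; start∈  = inj₁ refl
      ; _—[_]→_ = λ u a w → Entry u a w ⊎ Inner u a w
      ; →⊆      = λ { (inj₁ (refl , t)) → →⊆ (U⊆ t)
                    ; (inj₂ (_ , _ , t)) → →⊆ t }
      ; source∈ = λ { (inj₁ (u≡v , _)) → inj₁ u≡v
                    ; (inj₂ (r , _))   → inj₂ r }
      ; target∈ = λ { (inj₁ (_ , t))       → inj₂ (enter t)
                    ; (inj₂ (r , u≢v , t)) → inj₂ (onward r u≢v t) }
      }

  record LoopSub1Chart (K : Sub1Chart) : Set₁ where
    field
      hub      : V
      U        : Label A → V → Set
      U⊆       : ∀ {a w} → U a w → Sub1Chart._—[_]→_ K hub a w
      nonempty : ∃₂ U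
    open Generate K hub U U⊆ public using (Entry; generated)
    field
      isLoop   : IsLoop generated

  record MultiStep (K : Sub1Chart) : Set₁ where
    field
      n-1  : ℕ
      loop : Fin (suc n-1) → LoopSub1Chart K
    open module Loop i = LoopSub1Chart (loop i) public using (hub; Entry; generated)
    field
      disjoint  : ∀ {i j} → i ≢ j → ∀ {u a w} → ¬ (Entry i u a w × Entry j u a w)
      separated : ∀ {i j} → i ≢ j → ¬ InBody (generated i) (hub j)

    AnyEntry : Transitions A V
    AnyEntry u a w = ∃ λ i → Entry i u a w

  eliminate : ∀ {K} → MultiStep K → Sub1Chart
  eliminate {K} σ = record
      { Vertex  = Reachable
      ; start   = start K
      ; start∈  = ε
      ; _—[_]→_ = λ u a w → Reachable u × Remaining u a w
      ; →⊆      = λ (_ , t , _) → →⊆ t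
      ; source∈ = λ (r , _) → r
      ; target∈ = λ (r , t) → r ◅◅ ((_ , t) ◅ ε)
      }
    where
    open Sub1Chart K using (_—[_]→_; →⊆)

    Remaining : Transitions A V
    Remaining u a w = u —[ a ]→ w × ¬ MultiStep.AnyEntry σ u a w

    Reachable : Pred V 0ℓ
    Reachable = Star (Step Remaining) (start K)

  infixr 5 _∷_
  data Run (K : Sub1Chart) : Set₁ where
    []  : Run K
    _∷_ : (σ : MultiStep K) → Run (eliminate σ) → Run K

  final : ∀ {K} → Run K → Sub1Chart
  final {K} []  = K
  final (_ ∷ ρ) = final ρ

  Successful : ∀ {K} → Run K → Set
  Successful ρ = ¬ Sub1Chart.HasInfinitePath (final ρ)

  -- The transitions removed as loop-entry transitions in the multi-step
  -- with index k, where indices start from 0.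
  RemovedAt : ∀ {K} → Run K → ℕ → Transitions A V
  RemovedAt []      _       u a w = ⊥
  RemovedAt (σ ∷ ρ) zero    u a w = MultiStep.AnyEntry σ u a w
  RemovedAt (σ ∷ ρ) (suc k) u a w = RemovedAt ρ k u a w

  Layered : ∀ {K} → Run K → Set
  Layered []      = ⊤
  Layered (σ ∷ ρ) =
    (∀ i k {u a w} → RemovedAt ρ k u a w → ¬ InBody (MultiStep.generated σ i) u) × Layered ρ

  -- Labelings are total on V × Label A × V; their values outside of the
  -- transition relation of C are irrelevant.
  Labeling : Set
  Labeling = V → Label A → V → ℕ

  -- The label of a transition is suc k if it is removed as a loop-entry
  -- transition in the multi-step with index k, and hence 0 if there is no
  -- such k.
  Records : Labeling → Run whole → Set
  Records ℓ ρ = ∀ {u a w} → u —[ a ]→₀ w → ∀ k → (ℓ u a w ≡ suc k) ⇔ RemovedAt ρ k u a w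

  IsLLEEWitness : Labeling → Set₁
  IsLLEEWitness ℓ = ∃ λ (ρ : Run whole) → Successful ρ × Layered ρ × Records ℓ ρ

  Guarded : Labeling → Set
  Guarded ℓ = ∀ {u a w} → u —[ a ]→₀ w → 1 ≤ ℓ u a w → ∃ λ b → a ≡ proper b

GuardedLLEE : ∀ {A} → 1-Chart A → Set₁
GuardedLLEE C = ∃ λ ℓ → IsLLEEWitness ℓ × Guarded ℓ
  where open LoopElimination C

------------------------------------------------------------------------
-- Coinductive proofs and cMil

record CoinductiveProof {A : Set} {ℓ} (S : ProofSystem A ℓ) (e₁ e₂ : StExp A) :
                        Set (lsuc 0ℓ ⊔ˡ ℓ) where
  field
    chart : 1-Chart A
  open 1-Chart chart using (V; start; WeaklyGuarded)
  field
    weaklyGuarded : WeaklyGuarded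
    L             : V → Eq A
    solution₁     : IsSolution S chart (lhs ∘ L)
    solution₂     : IsSolution S chart (rhs ∘ L)
    start₁        : lhs (L start) ≡ e₁
    start₂        : rhs (L start) ≡ e₂

LLEE-Equal : ∀ {A ℓ} → ProofSystem A ℓ → StExp A → StExp A → Set (lsuc 0ℓ ⊔ˡ ℓ)
LLEE-Equal S e₁ e₂ =
  Σ (CoinductiveProof S e₁ e₂) λ P → GuardedLLEE (CoinductiveProof.chart P)

data LCoProof {A : Set} (n : ℕ) : Rule A (lsuc 0ℓ) where
  lCoProof : ∀ {Es e f} → length Es ≡ n →
             LLEE-Equal (Mil⁻ ⊞ (_∈ Es)) e f → LCoProof n Es (e ≐ f)

cMil : ∀ {A} → ProofSystem A (lsuc 0ℓ)
cMil = Mil⁻ ∪ λ Es E → ∃ λ n → LCoProof n Es E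

{-# OPTIONS --safe #-}

-- Modulo Mil⁻, every expression is τ + g with τ ∈ {𝟘, 𝟙} and g a guarded
-- expression in which no product or star has a dead (never terminating) left
-- factor or body.  If f is dead, then f · k = f for all k, so f · e + g = f ⋆ · g
-- is derivable equationally.  Otherwise f ⋆ · g is interpreted as a 1-chart that has,
-- for every star, a hub vertex to which the body of the star returns and that is
-- left for the continuation by a 1-transition.  Its proper transitions from hubs
-- are loop-entry transitions, and inner loops can be eliminated before outer
-- ones.  The chart is solved by e at its start vertex whenever e = f · e + g,
-- so both e and f ⋆ · g give solutions of it.

module Submission where

open import Defs
open import Data.Bool.Base using (Bool; true; false; if_then_else_; _∨_)
open import Data.Empty using (⊥)
open import Data.Fin.Base using (Fin; zero)
open import Data.Fin.Properties using (inj⇒≟; 0↔⊥; 1↔⊤; +↔⊎)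
open import Data.List.Base using (List; []; _∷_; map; _++_; [_])
open import Data.List.Membership.Propositional using (_∈_)
open import Data.List.Membership.Propositional.Properties using (∈-map⁻; ∈-++⁻; ∈-++⁺ˡ; ∈-++⁺ʳ)
open import Data.List.Properties using (map-++)
open import Data.List.Relation.Unary.All as All using (All; []; _∷_)
import Data.List.Relation.Unary.All.Properties as All
open import Data.List.Relation.Unary.AllPairs using (AllPairs; []; _∷_)
import Data.List.Relation.Unary.AllPairs.Properties as AllPairs
open import Data.List.Relation.Unary.Any using (here; there)
open import Data.Nat.Base using (ℕ; zero; suc; _≤_; z≤n; s≤s)
open import Data.Product.Base using (∃; ∃₂; _×_; _,_; proj₁; proj₂)
open import Data.Sum.Base using (_⊎_; inj₁; inj₂)
open import Data.Sum.Function.Propositional using (_⊎-↔_)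
open import Data.Sum.Properties using (inj₁-injective; inj₂-injective)
open import Data.Unit.Base using (⊤; tt)
open import Function.Base using (_∘_; flip; id)
open import Function.Bundles using (_↔_; mk⇔)
open import Function.Definitions using (Injective)
open import Function.Properties.Inverse using (↔⇒↣; ↔-sym; ↔-trans)
open import Induction.WellFounded using (WellFounded; Acc; acc)
open import Level using (0ℓ)
open import Relation.Binary.Bundles using (Setoid)
open import Relation.Binary.Construct.Closure.ReflexiveTransitive as Star using (Star; ε; _◅_; _◅◅_)
open import Relation.Binary.Construct.Closure.Transitive as Plus using (TransClosure)
open import Relation.Binary.Definitions using (DecidableEquality)
open import Relation.Binary.PropositionalEquality using (_≡_; _≢_; refl; sym; trans; subst; cong)
import Relation.Binary.Reasoning.Setoid as SetoidReasoning
open import Relation.Nullary.Decidable.Core using (yes; no)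
open import Relation.Nullary.Negation.Core using (¬_; contradiction)
open import Relation.Unary using (Pred; Decidable; ∅)

-- Loop elimination along a list of hubs

-- The walk carries the rest of a path to `h`. When that rest is `ε` the current vertex is `h`
-- itself, and the walk starts another round with `first` and `back`.
cycle⇒infinitePath : ∀ {A V} {T : Transitions A V} {h w} → Step T h w → Star (Step T) w h →
                     ∃ λ π → InfinitePath T π × π 0 ≡ h
cycle⇒infinitePath {V = V} {T} {h} first back = proj₁ ∘ at , step , refl
  where
  next : (∃ λ u → Star (Step T) u h) → (∃ λ u → Star (Step T) u h)
  next (_ , ε)     = _ , back
  next (_ , _ ◅ p) = _ , p

  step-next : ∀ p → Step T (proj₁ p) (proj₁ (next p))
  step-next (_ , ε)     = first
  step-next (_ , t ◅ _) = t

  at : ℕ → ∃ λ u → Star (Step T) u h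
  at zero    = h , ε
  at (suc i) = next (at i)

  step : ∀ i → Step T (proj₁ (at i)) (proj₁ (at (suc i)))
  step i = step-next (at i)

wf⇒noInfinitePath : ∀ {A V} {T : Transitions A V} {R : V → V → Set} → WellFounded (flip R) →
                    (∀ {u w} → Step T u w → R u w) → ∀ π → ¬ InfinitePath T π
wf⇒noInfinitePath {R = R} wf T⊆R π path = go 0 (wf (π 0))
  where
  go : ∀ i → ¬ Acc (flip R) (π i)
  go i (acc rs) = go (suc i) (rs (T⊆R (path i)))

module Peeling {A : Set} (C : 1-Chart A) (isHub : 1-Chart.V C → Bool) where
  open 1-Chart C using (V; V-finite; Terminates; _—[_]→_)
  open LoopElimination C
  open Sub1Chart using (start)

  _≟_ : DecidableEquality V
  _≟_ = inj⇒≟ (↔⇒↣ (proj₂ V-finite))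

  -- 1-transitions are never entries: the one from a hub is the exit of its loop. This makes the
  -- later labeling guarded.
  entry? : V → Label A → Bool
  entry? u (proper _) = isHub u
  entry? u one        = false

  -- The steps that are never removed as loop entries. Well-foundedness of this one relation gives
  -- (L2) for each loop, success of the run and the absence of cycles of 1-transitions.
  BodyStep : V → V → Set
  BodyStep u w = ∃ λ a → u —[ a ]→ w × entry? u a ≡ false

  -- Body may be larger than the set of body vertices of the loop at vertex:
  -- in the whole chart, paths can also run through the inner loops.
  record Hub : Set₁ where
    field
      vertex      : V
      Body        : Pred V 0ℓ
      enters      : ∀ {a w} → vertex —[ a ]→ w → entry? vertex a ≡ true → w ≡ vertex ⊎ Body w
      closed      : ∀ {u a w} → Body u → u —[ a ]→ w → w ≡ vertex ⊎ Body w
      ¬terminates : ∀ {u} → Body u → ¬ Terminates u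
      cycle       : ∃₂ λ a w → vertex —[ a ]→ w × entry? vertex a ≡ true × Star BodyStep w vertex

  open Hub

  hubVertices : List Hub → List V
  hubVertices = map vertex

  -- Deliberately asymmetric: `H` is eliminated before `H′`, so `vertex H` may lie in the body of
  -- `H′`, but not conversely. This is what layeredness needs.
  Separated : Hub → Hub → Set
  Separated H H′ = vertex H′ ≢ vertex H × ¬ Body H (vertex H′)

  separated-at : ∀ {H hs u} → All (Separated H) hs → u ∈ hubVertices hs → u ≢ vertex H × ¬ Body H u
  separated-at sep u∈ with ∈-map⁻ vertex u∈
  ... | _ , H′∈ , refl = All.lookup sep H′∈

  Path : Sub1Chart → V → V → Set
  Path K = Star (Step (Sub1Chart._—[_]→_ K))

  -- K arises from the whole chart by eliminating the loops at all hubs but hs.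
  record Stage (K : Sub1Chart) (hs : List Hub) : Set where
    private module K = Sub1Chart K
    field
      remaining : ∀ {u a w} → u K.—[ a ]→ w → entry? u a ≡ true → u ∈ hubVertices hs
      -- Restricted to vertices that are still reachable, since an elimination also discards
      -- everything that becomes unreachable.
      present   : ∀ {u a w} → Path K (start K) u → u —[ a ]→ w →
                  (entry? u a ≡ true → u ∈ hubVertices hs) → u K.—[ a ]→ w
      reachable : ∀ {u} → u ∈ hubVertices hs → Path K (start K) u

  module Peel (wf : WellFounded (flip BodyStep)) {K : Sub1Chart} {H : Hub} {hs : List Hub}
              (sep : All (Separated H) hs) (stage : Stage K (H ∷ hs)) where
    private module K = Sub1Chart K
    open Stage stage

    h : V
    h = vertex H

    U : Label A → V → Set
    U a w = h —[ a ]→ w × entry? h a ≡ true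

    U⊆ : ∀ {a w} → U a w → h K.—[ a ]→ w
    U⊆ (t , _) = present (reachable (here refl)) t (λ _ → here refl)

    open Generate K h U U⊆

    inner : ∀ {w} → Reached w → w ≡ h ⊎ Body H w
    inner (enter (t , e))    = enters H t e
    inner (onward r u≢h t) with inner r
    ... | inj₁ u≡h = contradiction u≡h u≢h
    ... | inj₂ b   = closed H b (K.→⊆ t)

    reached⇒reachable : ∀ {w} → Reached w → Path K (start K) w
    reached⇒reachable (enter u)      = reachable (here refl) ◅◅ ((_ , U⊆ u) ◅ ε)
    reached⇒reachable (onward r _ t) = reached⇒reachable r ◅◅ ((_ , t) ◅ ε)

    -- All loops inside the body are already gone: an entry transition left at `u` would make `u`
    -- either `h`, which is excluded, or a later hub, and those lie outside of `Body H`.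
    inner-step : ∀ {u a w} → Reached u → u ≢ h → u K.—[ a ]→ w → BodyStep u w
    inner-step {u} {a} r u≢h t with entry? u a in eq
    ... | false = a , K.→⊆ t , eq
    ... | true with remaining t eq | inner r
    ...   | here u≡h | _        = contradiction u≡h u≢h
    ...   | there _  | inj₁ u≡h = contradiction u≡h u≢h
    ...   | there u∈ | inj₂ b   = contradiction b (proj₂ (separated-at {H} sep u∈))

    -- The given path is cut off at its first visit to `h`. Its steps are still in `K` because body
    -- steps are never removed.
    back : ∀ {w} → Reached w → Star BodyStep w h → Path generated w h
    back r ε = ε
    back {w} r ((a , t , e) ◅ p) with w ≟ h
    ... | yes refl = ε
    ... | no w≢h = (a , inj₂ (r , w≢h , t′)) ◅ back (onward r w≢h t′) p
      where
      t′ : w K.—[ a ]→ _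
      t′ = present (reached⇒reachable r) t (λ e′ → contradiction (trans (sym e′) e) λ ())

    isLoop : IsLoop generated
    isLoop = record { L1 = infinite ; L2 = returns ; L3 = onlyHub }
      where
      infinite : ∃ λ π → InfinitePath (Sub1Chart._—[_]→_ generated) π × π 0 ≡ h
      infinite with cycle H
      ... | _ , _ , t , e , p =
        cycle⇒infinitePath (_ , inj₁ (refl , t , e)) (back (enter (t , e)) p)

      returns : ∀ π → InfinitePath (Sub1Chart._—[_]→_ generated) π → π 0 ≡ h →
                ∃ λ k → 1 ≤ k × π k ≡ h
      -- The first step is a loop entry and no body step, so the descent starts at index 1. A path
      -- that avoided `h` from there on would be an infinite chain of body steps.
      returns π path π0≡h = go 0 (first (path 0)) (wf (π 1))
        where
        first : Step (Sub1Chart._—[_]→_ generated) (π 0) (π 1) → Reached (π 1)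
        first (_ , inj₁ (_ , u))       = enter u
        first (_ , inj₂ (_ , π0≢h , _)) = contradiction π0≡h π0≢h

        go : ∀ i → Reached (π (suc i)) → Acc (flip BodyStep) (π (suc i)) → ∃ λ k → 1 ≤ k × π k ≡ h
        go i r (acc rs) with π (suc i) ≟ h
        ... | yes eq = suc i , s≤s z≤n , eq
        ... | no ≢h with path (suc i)
        ...   | _ , inj₁ (≡h , _)    = contradiction ≡h ≢h
        ...   | _ , inj₂ (_ , _ , t) = go (suc i) (onward r ≢h t) (rs (inner-step r ≢h t))

      onlyHub : ∀ {w} → w ≡ h ⊎ Reached w → Terminates w → w ≡ h
      onlyHub (inj₁ w≡h) _ = w≡h
      onlyHub (inj₂ r)   ↓w with inner r
      ... | inj₁ w≡h = w≡h
      ... | inj₂ b   = contradiction ↓w (¬terminates H b)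

    multiStep : MultiStep K
    multiStep = record
      -- Each multi-step removes a single loop, so disjointness and separation within it are
      -- vacuous.
      { n-1       = 0
      ; loop      = λ _ → record
        { hub = h ; U = U ; U⊆ = U⊆ ; isLoop = isLoop
        ; nonempty = let a , w , t , e , _ = cycle H in a , w , t , e }
      ; disjoint  = λ { {zero} {zero} i≢j → contradiction refl i≢j }
      ; separated = λ { {zero} {zero} i≢j → contradiction refl i≢j }
      }

    K′ : Sub1Chart
    K′ = eliminate multiStep

    removed : ∀ {u a w} → u ≡ h → u —[ a ]→ w → entry? u a ≡ true →
              MultiStep.AnyEntry multiStep u a w
    removed refl t e = zero , refl , t , e

    -- Serves two purposes: layeredness of the run, and that later hubs do not become unreachable
    -- when this loop is removed.
    body-separated : ∀ {u} → u ∈ hubVertices hs → ¬ InBody generated u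
    body-separated u∈ (inj₁ u≡h , u≢h) = u≢h u≡h
    body-separated u∈ (inj₂ r , u≢h) with inner r
    ... | inj₁ u≡h = u≢h u≡h
    ... | inj₂ b   = proj₂ (separated-at {H} sep u∈) b

    Kept : V → Set
    Kept = Path K′ (start K)

    kept-step : ∀ {u a w} → Kept u → u K.—[ a ]→ w → (u ≡ h → entry? u a ≢ true) → Kept w
    kept-step p t ¬e =
      -- A transition of `K′` contains a proof that its source is reachable by remaining
      -- transitions; the map extracts it from `p`.
      p ◅◅ ((_ , Star.map (λ (a , _ , r) → a , r) p , t , λ { (_ , refl , _ , e) → ¬e refl e }) ◅ ε)

    -- Vertices that become unreachable are in the body of the eliminated loop.
    kept-or-reached : ∀ {u w} → Path K u w → Kept u ⊎ (Kept h × Reached u) →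
                      Kept w ⊎ (Kept h × Reached w)
    kept-or-reached ε s = s
    kept-or-reached {u} ((a , t) ◅ p) s = kept-or-reached p (step s)
      where
      step-kept : Kept u → Kept _ ⊎ (Kept h × Reached _)
      step-kept k with u ≟ h | entry? u a in eq
      ... | no u≢h   | _     = inj₁ (kept-step k t (λ u≡h → contradiction u≡h u≢h))
      ... | yes _    | false = inj₁ (kept-step k t (λ _ e → contradiction (trans (sym e) eq) λ ()))
      ... | yes refl | true  = inj₂ (k , enter (K.→⊆ t , eq))

      step : Kept u ⊎ (Kept h × Reached u) → Kept _ ⊎ (Kept h × Reached _)
      step (inj₁ k)       = step-kept k
      step (inj₂ (k , r)) with u ≟ h
      -- The path is back at `h`, which is known to be kept, so the case of a kept vertex applies
      -- again.
      ... | yes refl = step-kept k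
      ... | no u≢h   = inj₂ (k , onward r u≢h t)

    nextStage : Stage K′ hs
    nextStage = record { remaining = remaining′ ; present = present′ ; reachable = reachable′ }
      where
      remaining′ : ∀ {u a w} → Sub1Chart._—[_]→_ K′ u a w → entry? u a ≡ true → u ∈ hubVertices hs
      remaining′ (_ , t , ¬r) e with remaining t e
      ... | here u≡h = contradiction (removed u≡h (K.→⊆ t) e) ¬r
      ... | there u∈ = u∈

      present′ : ∀ {u a w} → Kept u → u —[ a ]→ w →
                 (entry? u a ≡ true → u ∈ hubVertices hs) → Sub1Chart._—[_]→_ K′ u a w
      present′ p t e⇒∈ =
        Star.map (λ (a , _ , r) → a , r) p
        , present (Star.map (λ (a , _ , t , _) → a , t) p) t (there ∘ e⇒∈)
        , λ { (_ , refl , _ , e) → proj₁ (separated-at {H} sep (e⇒∈ e)) refl }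

      reachable′ : ∀ {u} → u ∈ hubVertices hs → Kept u
      reachable′ u∈ with kept-or-reached (reachable (there u∈)) (inj₁ ε)
      ... | inj₁ k       = k
      ... | inj₂ (_ , r) =
        contradiction (inj₂ r , proj₁ (separated-at {H} sep u∈)) (body-separated u∈)

  module _ (wf : WellFounded (flip BodyStep)) where

    run : ∀ {K} hs → AllPairs Separated hs → Stage K hs → Run K
    run []       _            _     = []
    run (H ∷ hs) (sep ∷ seps) stage = multiStep ∷ run hs seps nextStage
      where open Peel wf sep stage

    run-successful : ∀ {K} hs seps (stage : Stage K hs) → Successful (run hs seps stage)
    run-successful {K} [] _ stage (π , path) = wf⇒noInfinitePath wf body π path
      where
      body : ∀ {u w} → Step (Sub1Chart._—[_]→_ K) u w → BodyStep u w
      body {u} (a , t) with entry? u a in eq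
      ... | false = a , Sub1Chart.→⊆ K t , eq
      ... | true with Stage.remaining stage t eq
      ...   | ()
    run-successful (H ∷ hs) (sep ∷ seps) stage =
      run-successful hs seps (Peel.nextStage wf sep stage)

    removed⇒hub : ∀ {K} hs seps (stage : Stage K hs) k {u a w} →
                  RemovedAt (run hs seps stage) k u a w → u ∈ hubVertices hs
    removed⇒hub (H ∷ hs) (sep ∷ seps) stage zero    (_ , u≡h , _) = here u≡h
    removed⇒hub (H ∷ hs) (sep ∷ seps) stage (suc k) r =
      there (removed⇒hub hs seps (Peel.nextStage wf sep stage) k r)

    run-layered : ∀ {K} hs seps (stage : Stage K hs) → Layered (run hs seps stage)
    run-layered [] _ _ = tt
    run-layered (H ∷ hs) (sep ∷ seps) stage =
      (λ _ k r → Peel.body-separated wf sep stage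
                   (removed⇒hub hs seps (Peel.nextStage wf sep stage) k r))
      , run-layered hs seps (Peel.nextStage wf sep stage)

    -- Moves a position past one more list element, but fixes 0, which stands for absence.
    shift : ℕ → ℕ
    shift zero    = zero
    shift (suc n) = suc (suc n)

    -- 1 + the index of the first occurrence, or 0 if there is none
    position : List V → V → ℕ
    position []       u = 0
    position (v ∷ vs) u with u ≟ v
    ... | yes _ = 1
    ... | no _  = shift (position vs u)

    labeling : List Hub → Labeling
    labeling hs u a w = if entry? u a then position (hubVertices hs) u else 0

    position⇒removed : ∀ {K} hs seps (stage : Stage K hs) k {u a w} → u —[ a ]→ w →
                       entry? u a ≡ true → position (hubVertices hs) u ≡ suc k →
                       RemovedAt (run hs seps stage) k u a w
    position⇒removed (H ∷ hs) (sep ∷ seps) stage k {u} t e eq with u ≟ vertex H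
    position⇒removed (H ∷ hs) (sep ∷ seps) stage zero t e refl | yes u≡h =
      Peel.removed wf sep stage u≡h t e
    ... | no _ with position (hubVertices hs) u in eq′
    position⇒removed (H ∷ hs) (sep ∷ seps) stage (suc k) t e refl | no _ | suc _ =
      position⇒removed hs seps (Peel.nextStage wf sep stage) k t e eq′

    removed⇒position : ∀ {K} hs seps (stage : Stage K hs) k {u a w} →
                       RemovedAt (run hs seps stage) k u a w →
                       entry? u a ≡ true × position (hubVertices hs) u ≡ suc k
    removed⇒position (H ∷ hs) (sep ∷ seps) stage k {u} r with u ≟ vertex H
    removed⇒position (H ∷ hs) (sep ∷ seps) stage zero    (_ , refl , _ , e) | yes _ = e , refl
    removed⇒position (H ∷ hs) (sep ∷ seps) stage zero    (_ , u≡h , _)      | no u≢h =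
      contradiction u≡h u≢h
    -- No vertex is a hub twice: later hubs differ from `vertex H`, so the first occurrence is the
    -- only one.
    removed⇒position (H ∷ hs) (sep ∷ seps) stage (suc k) r | yes u≡h =
      contradiction u≡h (proj₁ (separated-at {H} sep
        (removed⇒hub hs seps (Peel.nextStage wf sep stage) k r)))
    removed⇒position (H ∷ hs) (sep ∷ seps) stage (suc k) r | no _ =
      let e , eq = removed⇒position hs seps (Peel.nextStage wf sep stage) k r in
      e , cong shift eq

    run-records : ∀ hs seps (stage : Stage whole hs) → Records (labeling hs) (run hs seps stage)
    run-records hs seps stage {u} {a} {w} t k = mk⇔ to from
      where
      to : labeling hs u a w ≡ suc k → RemovedAt (run hs seps stage) k u a w
      to eq with entry? u a in e
      ... | true = position⇒removed hs seps stage k t e eq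

      from : RemovedAt (run hs seps stage) k u a w → labeling hs u a w ≡ suc k
      from r with removed⇒position hs seps stage k r
      ... | e , eq rewrite e = eq

    guardedLLEE : ∀ hs → AllPairs Separated hs →
                  (∀ u → isHub u ≡ true → u ∈ hubVertices hs) →
                  (∀ {u} → u ∈ hubVertices hs → Path whole (start whole) u) →
                  GuardedLLEE C
    guardedLLEE hs seps complete reachable =
      labeling hs
      , (run hs seps stage , run-successful hs seps stage , run-layered hs seps stage
        , run-records hs seps stage)
      , guarded
      where
      entry⇒hub : ∀ {u} a → entry? u a ≡ true → isHub u ≡ true
      entry⇒hub (proper _) e = e

      stage : Stage whole hs
      stage = record
        { remaining = λ {u} {a} _ e → complete u (entry⇒hub a e)
        ; present   = λ _ t _ → t
        ; reachable = reachable
        }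

      guarded : Guarded (labeling hs)
      -- For `one` the label computes to 0, which rules that case out.
      guarded {a = proper b} _ _ = b , refl

-- Equational reasoning and normal forms

module _ {A : Set} {ℓ₁ ℓ₂ ℓ₃ ℓ₄} {S : ProofSystem A ℓ₁} {Δ : Pred (Eq A) ℓ₂}
         {S′ : ProofSystem A ℓ₃} {Δ′ : Pred (Eq A) ℓ₄}
         (rule : ∀ {Es E} → S Es E → S′ Es E) (hyp : ∀ {E} → Δ E → S′ ∣ Δ′ ⊢ E) where

  -- Used to weaken assumptions, to turn assumptions into axioms, and to move from `Mil⁻` to `cMil`.
  -- The separate `translateAll` keeps the recursion structural.
  translate    : ∀ {E} → S ∣ Δ ⊢ E → S′ ∣ Δ′ ⊢ E
  translateAll : ∀ {Es} → All (S ∣ Δ ⊢_) Es → All (S′ ∣ Δ′ ⊢_) Es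

  translate (assumption d) = hyp d
  translate (infer r ds)   = infer (rule r) (translateAll ds)

  translateAll []       = []
  translateAll (d ∷ ds) = translate d ∷ translateAll ds

module Equational {A : Set} (Δ : Pred (Eq A) 0ℓ) where

  infix 4 _≈_
  _≈_ : StExp A → StExp A → Set
  e ≈ f = Mil⁻ ∣ Δ ⊢ e ≐ f

  ≈-refl : ∀ {e} → e ≈ e
  ≈-refl = infer (inj₁ reflexivity) []

  ≈-sym : ∀ {e f} → e ≈ f → f ≈ e
  ≈-sym p = infer (inj₁ symmetry) (p ∷ [])

  ≈-trans : ∀ {e f g} → e ≈ f → f ≈ g → e ≈ g
  ≈-trans p q = infer (inj₁ transitivity) (p ∷ q ∷ [])

  ≈-setoid : Setoid 0ℓ 0ℓ
  ≈-setoid = record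
    { Carrier = StExp A ; _≈_ = _≈_
    ; isEquivalence = record { refl = ≈-refl ; sym = ≈-sym ; trans = ≈-trans }
    }

  open SetoidReasoning ≈-setoid public

  ax : ∀ {E} → Mil⁻-Axiom E → Mil⁻ ∣ Δ ⊢ E
  ax a = infer (inj₂ (axiom a)) []

  +-congˡ : ∀ {e f g} → f ≈ g → e + f ≈ e + g
  +-congˡ {e} p = infer (inj₁ (context (e +ʳ □))) (p ∷ [])

  +-congʳ : ∀ {e f g} → f ≈ g → f + e ≈ g + e
  +-congʳ {e} p = infer (inj₁ (context (□ +ˡ e))) (p ∷ [])

  +-cong : ∀ {e e′ f f′} → e ≈ e′ → f ≈ f′ → e + f ≈ e′ + f′
  +-cong p q = ≈-trans (+-congˡ q) (+-congʳ p)

  ·-congˡ : ∀ {e f g} → f ≈ g → e · f ≈ e · g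
  ·-congˡ {e} p = infer (inj₁ (context (e ·ʳ □))) (p ∷ [])

  ·-congʳ : ∀ {e f g} → f ≈ g → f · e ≈ g · e
  ·-congʳ {e} p = infer (inj₁ (context (□ ·ˡ e))) (p ∷ [])

  ⋆-cong : ∀ {e f} → e ≈ f → e ⋆ ≈ f ⋆
  ⋆-cong p = infer (inj₁ (context (□ ⋆□))) (p ∷ [])

  +-identityˡ : ∀ {e} → 𝟘 + e ≈ e
  +-identityˡ = ≈-trans (ax +-comm) (ax +-identity)

  +-interchange : ∀ {a b c d} → (a + b) + (c + d) ≈ (a + c) + (b + d)
  +-interchange {a} {b} {c} {d} = begin
    (a + b) + (c + d)  ≈⟨ ax +-assoc ⟩
    a + (b + (c + d))  ≈⟨ +-congˡ (ax +-assoc) ⟨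
    a + ((b + c) + d)  ≈⟨ +-congˡ (+-congʳ (ax +-comm)) ⟩
    a + ((c + b) + d)  ≈⟨ +-congˡ (ax +-assoc) ⟩
    a + (c + (b + d))  ≈⟨ ax +-assoc ⟨
    (a + c) + (b + d)  ∎

  -- Since `foldl` accumulates in the head, the induction is over all heads: the hypothesis is used
  -- at `e + f` and at `f`.
  ∑-∷ : ∀ e es → ∑ (e ∷ es) ≈ e + ∑ es
  ∑-∷ e []       = ≈-sym (ax +-identity)
  ∑-∷ e (f ∷ es) = begin
    ∑ (e + f ∷ es)    ≈⟨ ∑-∷ (e + f) es ⟩
    (e + f) + ∑ es    ≈⟨ ax +-assoc ⟩
    e + (f + ∑ es)    ≈⟨ +-congˡ (∑-∷ f es) ⟨
    e + ∑ (f ∷ es)    ∎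

  ⋆-unfold-· : ∀ {f k} → f ⋆ · k ≈ k + f · (f ⋆ · k)
  ⋆-unfold-· {f} {k} = begin
    f ⋆ · k                 ≈⟨ ·-congʳ (ax ⋆-unfold) ⟩
    (𝟙 + f · f ⋆) · k       ≈⟨ ax ·-distribʳ ⟩
    𝟙 · k + (f · f ⋆) · k   ≈⟨ +-cong (ax ·-identityˡ) (ax ·-assoc) ⟩
    k + f · (f ⋆ · k)       ∎

mutual
  -- The index tells whether termination can be reached.  Products and loops
  -- over dead expressions are excluded: then every star gives rise to a loop
  -- sub-1-chart, and every hub is reachable.
  infixl 7 _⊕_
  infixl 8 _⊙_
  data Guarded (A : Set) : Bool → Set where
    nil  : Guarded A false
    act  : A → Guarded A true
    _⊕_  : ∀ {b c} → Guarded A b → Guarded A c → Guarded A (b ∨ c)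
    _⊙_  : ∀ {c} → Guarded A true → Segment A c → Guarded A c

  -- Right factors of products. Unlike guarded expressions they may terminate immediately, and stars
  -- occur only here.
  data Segment (A : Set) : Bool → Set where
    plain : ∀ τ {b} → Guarded A b → Segment A (τ ∨ b)
    loop  : Guarded A true → Segment A true

bit : ∀ {A} → Bool → StExp A
bit τ = if τ then 𝟙 else 𝟘

⟪_⟫ : ∀ {A b} → Guarded A b → StExp A
⟪_⟫ₛ : ∀ {A b} → Segment A b → StExp A

⟪ nil ⟫   = 𝟘
⟪ act a ⟫ = act a
⟪ g ⊕ h ⟫ = ⟪ g ⟫ + ⟪ h ⟫
⟪ g ⊙ x ⟫ = ⟪ g ⟫ · ⟪ x ⟫ₛ

⟪ plain τ g ⟫ₛ = bit τ + ⟪ g ⟫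
⟪ loop g ⟫ₛ    = ⟪ g ⟫ ⋆

module DeadExpressions {A : Set} (Δ : Pred (Eq A) 0ℓ) where
  open Equational Δ

  -- No run of a dead expression gets to `k`: `nil` absorbs it, and a product passes it on to its
  -- right factor, which is dead too. The index is constrained by an equation because `b ∨ c` does
  -- not unify with `false`.
  dead-·  : ∀ {b} (g : Guarded A b) → b ≡ false → ∀ {k} → ⟪ g ⟫ · k ≈ ⟪ g ⟫
  dead-·ₛ : ∀ {b} (x : Segment A b) → b ≡ false → ∀ {k} → ⟪ x ⟫ₛ · k ≈ ⟪ x ⟫ₛ

  dead-· nil _ = ax ·-zeroˡ
  dead-· (_⊕_ {false} g h) eq = ≈-trans (ax ·-distribʳ) (+-cong (dead-· g refl) (dead-· h eq))
  dead-· (g ⊙ x) eq = ≈-trans (ax ·-assoc) (·-congˡ (dead-·ₛ x eq))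

  dead-·ₛ (plain false g) eq =
    ≈-trans (ax ·-distribʳ) (+-cong (ax ·-zeroˡ) (dead-· g eq))

module _ {A : Set} where
  open Equational {A} ∅
  open DeadExpressions {A} ∅

  infixl 8 _⊙?_
  _⊙?_ : ∀ {b c} → Guarded A b → Segment A c → ∃ (Guarded A)
  _⊙?_ {b = false} g x = _ , g
  _⊙?_ {b = true}  g x = _ , g ⊙ x

  ⊙?-sound : ∀ {b c} (g : Guarded A b) (x : Segment A c) → ⟪ proj₂ (g ⊙? x) ⟫ ≈ ⟪ g ⟫ · ⟪ x ⟫ₛ
  ⊙?-sound {b = false} g x = ≈-sym (dead-· g refl)
  ⊙?-sound {b = true}  g x = ≈-refl

  -- The field `τ⇒↓` is read contrapositively: it turns the side condition of `RSP⋆` into the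
  -- absence of the summand `𝟙`.
  record NormalForm (e : StExp A) : Set where
    field
      τ       : Bool
      normed  : Bool
      guarded : Guarded A normed
      sound   : e ≈ bit τ + ⟪ guarded ⟫
      τ⇒↓     : τ ≡ true → e ↓

  open NormalForm

  bit-∨ : ∀ τ σ → bit τ + bit σ ≈ bit (τ ∨ σ)
  bit-∨ false σ     = +-identityˡ
  bit-∨ true  false = ax +-identity
  bit-∨ true  true  = ax +-idem

  nf-+ : ∀ {e f : StExp A} → NormalForm e → NormalForm f → NormalForm (e + f)
  nf-+ {e = e} {f} n m = record
    { τ = τ n ∨ τ m ; guarded = guarded n ⊕ guarded m
    ; sound = begin
        e + f
          ≈⟨ +-cong (sound n) (sound m) ⟩
        (bit (τ n) + ⟪ guarded n ⟫) + (bit (τ m) + ⟪ guarded m ⟫)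
          ≈⟨ +-interchange ⟩
        (bit (τ n) + bit (τ m)) + (⟪ guarded n ⟫ + ⟪ guarded m ⟫)
          ≈⟨ +-congʳ (bit-∨ (τ n) (τ m)) ⟩
        bit (τ n ∨ τ m) + (⟪ guarded n ⟫ + ⟪ guarded m ⟫) ∎
    ; τ⇒↓ = terminates (τ n) (τ⇒↓ n) (τ⇒↓ m)
    }
    where
    terminates : ∀ σ → (σ ≡ true → e ↓) → (τ m ≡ true → f ↓) → σ ∨ τ m ≡ true → e + f ↓
    terminates true  p q _  = +↓ˡ (p refl)
    terminates false p q eq = +↓ʳ (q eq)

  nf-· : ∀ {e f : StExp A} → NormalForm e → NormalForm f → NormalForm (e · f)
  nf-· {e = e} {f} record { τ = false ; guarded = g ; sound = e≈ } m = record
    { τ = false ; guarded = proj₂ (g ⊙? plain (τ m) (guarded m))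
    ; sound = begin
        e · f
          ≈⟨ ·-congʳ (≈-trans e≈ +-identityˡ) ⟩
        ⟪ g ⟫ · f
          ≈⟨ ·-congˡ (sound m) ⟩
        ⟪ g ⟫ · (bit (τ m) + ⟪ guarded m ⟫)
          ≈⟨ ⊙?-sound g (plain (τ m) (guarded m)) ⟨
        ⟪ proj₂ (g ⊙? plain (τ m) (guarded m)) ⟫
          ≈⟨ +-identityˡ ⟨
        𝟘 + ⟪ proj₂ (g ⊙? plain (τ m) (guarded m)) ⟫ ∎
    ; τ⇒↓ = λ ()
    }
  nf-· {e = e} {f} record { τ = true ; guarded = g ; sound = e≈ ; τ⇒↓ = e↓ } m = record
    { τ = τ m ; guarded = guarded m ⊕ proj₂ (g ⊙? plain (τ m) (guarded m))
    ; sound = begin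
        e · f
          ≈⟨ ·-congʳ e≈ ⟩
        (𝟙 + ⟪ g ⟫) · f
          ≈⟨ ax ·-distribʳ ⟩
        𝟙 · f + ⟪ g ⟫ · f
          ≈⟨ +-cong (≈-trans (ax ·-identityˡ) (sound m)) (·-congˡ (sound m)) ⟩
        (bit (τ m) + ⟪ guarded m ⟫) + ⟪ g ⟫ · (bit (τ m) + ⟪ guarded m ⟫)
          ≈⟨ ax +-assoc ⟩
        bit (τ m) + (⟪ guarded m ⟫ + ⟪ g ⟫ · (bit (τ m) + ⟪ guarded m ⟫))
          ≈⟨ +-congˡ (+-congˡ (⊙?-sound g (plain (τ m) (guarded m)))) ⟨
        bit (τ m) + (⟪ guarded m ⟫ + ⟪ proj₂ (g ⊙? plain (τ m) (guarded m)) ⟫) ∎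
    ; τ⇒↓ = λ eq → ·↓ (e↓ refl) (τ⇒↓ m eq)
    }

  -- The axiom `⋆-𝟙+` strips immediate termination from the body, and one unfolding then exposes the
  -- guarded expression `g ⊙ loop g`. If `g` is dead, the product collapses to `g` and the star
  -- disappears.
  nf-⋆ : ∀ {e : StExp A} → NormalForm e → NormalForm (e ⋆)
  nf-⋆ {e} n = star (normed n) (guarded n) e⋆≈
    where
    drop : ∀ σ {g : StExp A} → (bit σ + g) ⋆ ≈ g ⋆
    drop false = ⋆-cong +-identityˡ
    drop true  = ≈-sym (ax ⋆-𝟙+)

    e⋆≈ : e ⋆ ≈ 𝟙 + ⟪ guarded n ⟫ · ⟪ guarded n ⟫ ⋆
    e⋆≈ = ≈-trans (⋆-cong (sound n)) (≈-trans (drop (τ n)) (ax ⋆-unfold))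

    star : ∀ b (g : Guarded A b) → e ⋆ ≈ 𝟙 + ⟪ g ⟫ · ⟪ g ⟫ ⋆ → NormalForm (e ⋆)
    star true  g eq = record { τ = true ; guarded = g ⊙ loop g ; sound = eq ; τ⇒↓ = λ _ → ⋆↓ }
    star false g eq = record
      { τ = true ; guarded = g ; sound = ≈-trans eq (+-congˡ (dead-· g refl)) ; τ⇒↓ = λ _ → ⋆↓ }

  nf : ∀ (e : StExp A) → NormalForm e
  nf 𝟘       = record { τ = false ; guarded = nil ; sound = ≈-sym (ax +-identity) ; τ⇒↓ = λ () }
  nf 𝟙       = record { τ = true ; guarded = nil ; sound = ≈-sym (ax +-identity) ; τ⇒↓ = λ _ → 𝟙↓ }
  nf (act a) = record { τ = false ; guarded = act a ; sound = ≈-sym +-identityˡ ; τ⇒↓ = λ () }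
  nf (e + f) = nf-+ (nf e) (nf f)
  nf (e · f) = nf-· (nf e) (nf f)
  nf (e ⋆)   = nf-⋆ (nf e)

-- Charts of guarded expressions

-- Vertices are the expressions reached after at least one action; the
-- first vertex of a segment is its entry.
Vertex  : ∀ {A b} → Guarded A b → Set
Vertexₛ : ∀ {A b} → Segment A b → Set

Vertex nil     = ⊥
-- The action leads to the continuation, whose vertex is supplied from outside.
Vertex (act _) = ⊥
Vertex (g ⊕ h) = Vertex g ⊎ Vertex h
Vertex (g ⊙ x) = Vertex g ⊎ Vertexₛ x

Vertexₛ (plain _ g) = ⊤ ⊎ Vertex g
Vertexₛ (loop g)    = ⊤ ⊎ Vertex g

entry : ∀ {A b} (x : Segment A b) → Vertexₛ x
entry (plain _ _) = inj₁ tt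
entry (loop _)    = inj₁ tt

Finite : Set → Set
Finite X = ∃ λ n → X ↔ Fin n

⊥-finite : Finite ⊥
⊥-finite = _ , ↔-sym 0↔⊥

⊤-finite : Finite ⊤
⊤-finite = _ , ↔-sym 1↔⊤

⊎-finite : ∀ {X Y} → Finite X → Finite Y → Finite (X ⊎ Y)
⊎-finite (_ , i) (_ , j) = _ , ↔-trans (i ⊎-↔ j) (↔-sym +↔⊎)

vertex-finite  : ∀ {A b} (g : Guarded A b) → Finite (Vertex g)
vertexₛ-finite : ∀ {A b} (x : Segment A b) → Finite (Vertexₛ x)

vertex-finite nil     = ⊥-finite
vertex-finite (act _) = ⊥-finite
vertex-finite (g ⊕ h) = ⊎-finite (vertex-finite g) (vertex-finite h)
vertex-finite (g ⊙ x) = ⊎-finite (vertex-finite g) (vertexₛ-finite x)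

vertexₛ-finite (plain _ g) = ⊎-finite ⊤-finite (vertex-finite g)
vertexₛ-finite (loop g)    = ⊎-finite ⊤-finite (vertex-finite g)

hub?  : ∀ {A b} (g : Guarded A b) → Vertex g → Bool
hub?ₛ : ∀ {A b} (x : Segment A b) → Vertexₛ x → Bool

hub? (g ⊕ h) (inj₁ v) = hub? g v
hub? (g ⊕ h) (inj₂ v) = hub? h v
hub? (g ⊙ x) (inj₁ v) = hub? g v
hub? (g ⊙ x) (inj₂ v) = hub?ₛ x v

hub?ₛ (plain τ g) (inj₁ tt) = false
hub?ₛ (plain τ g) (inj₂ v)  = hub? g v
hub?ₛ (loop g)    (inj₁ tt) = true
hub?ₛ (loop g)    (inj₂ v)  = hub? g v

Image : ∀ {X W : Set} → (X → W) → Pred W 0ℓ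
Image φ w = ∃ λ v → φ v ≡ w

module _ {A W : Set} where

  -- Transitions into an ambient vertex set W, given the embedding φ of the
  -- vertices and the vertex k where the chart continues upon termination.
  tick : Bool → W → List (Label A × W)
  tick τ k = if τ then [ one , k ] else []

  init : ∀ {b} (g : Guarded A b) → (Vertex g → W) → W → List (Label A × W)
  init nil     φ k = []
  init (act a) φ k = [ proper a , k ]
  init (g ⊕ h) φ k = init g (φ ∘ inj₁) k ++ init h (φ ∘ inj₂) k
  init (g ⊙ x) φ k = init g (φ ∘ inj₁) (φ (inj₂ (entry x)))

  out  : ∀ {b} (g : Guarded A b) → (Vertex g → W) → W → Vertex g → List (Label A × W)
  outₛ : ∀ {b} (x : Segment A b) → (Vertexₛ x → W) → W → Vertexₛ x → List (Label A × W)

  out (g ⊕ h) φ k (inj₁ v) = out g (φ ∘ inj₁) k v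
  out (g ⊕ h) φ k (inj₂ v) = out h (φ ∘ inj₂) k v
  out (g ⊙ x) φ k (inj₁ v) = out g (φ ∘ inj₁) (φ (inj₂ (entry x))) v
  out (g ⊙ x) φ k (inj₂ v) = outₛ x (φ ∘ inj₂) k v

  outₛ (plain τ g) φ k (inj₁ tt) = tick τ k ++ init g (φ ∘ inj₂) k
  outₛ (plain τ g) φ k (inj₂ v)  = out g (φ ∘ inj₂) k v
  outₛ (loop g)    φ k (inj₁ tt) = (one , k) ∷ init g (φ ∘ inj₂) (φ (inj₁ tt))
  outₛ (loop g)    φ k (inj₂ v)  = out g (φ ∘ inj₂) (φ (inj₁ tt)) v

  private
    exit-or : ∀ {X Y : Set} {φ : X → W} {k w} (ι : Y → X) →
              w ≡ k ⊎ Image (φ ∘ ι) w → w ≡ k ⊎ Image φ w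
    exit-or ι (inj₁ w≡k)      = inj₁ w≡k
    exit-or ι (inj₂ (v , eq)) = inj₂ (ι v , eq)

    through : ∀ {X Y : Set} {φ : X → W} {k w} (ι : Y → X) (v : X) →
              w ≡ φ v ⊎ Image (φ ∘ ι) w → w ≡ k ⊎ Image φ w
    through ι v (inj₁ w≡)       = inj₂ (v , sym w≡)
    through ι v (inj₂ (u , eq)) = inj₂ (ι u , eq)

  tick-target : ∀ τ {k a w} → (a , w) ∈ tick τ k → w ≡ k
  tick-target true (here refl) = refl

  init-targets : ∀ {b} (g : Guarded A b) {φ k a w} → (a , w) ∈ init g φ k → w ≡ k ⊎ Image φ w
  init-targets (act _) (here refl) = inj₁ refl
  init-targets (g ⊕ h) {φ} {k} t with ∈-++⁻ (init g (φ ∘ inj₁) k) t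
  ... | inj₁ t = exit-or inj₁ (init-targets g t)
  ... | inj₂ t = exit-or inj₂ (init-targets h t)
  init-targets (g ⊙ x) t = through inj₁ (inj₂ (entry x)) (init-targets g t)

  -- Hence all transitions from a hub, except its exit, are loop entries.
  init-proper : ∀ {b} (g : Guarded A b) {φ k a w} → (a , w) ∈ init g φ k → ∃ λ c → a ≡ proper c
  init-proper (act c) (here refl) = c , refl
  init-proper (g ⊕ h) {φ} {k} t with ∈-++⁻ (init g (φ ∘ inj₁) k) t
  ... | inj₁ t = init-proper g t
  ... | inj₂ t = init-proper h t
  init-proper (g ⊙ x) t = init-proper g t

  plain-targets : ∀ τ {b} (g : Guarded A b) {φ k a w} →
                  (a , w) ∈ tick τ k ++ init g φ k → w ≡ k ⊎ Image φ w
  plain-targets τ g {k = k} t with ∈-++⁻ (tick τ k) t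
  ... | inj₁ t = inj₁ (tick-target τ t)
  ... | inj₂ t = init-targets g t

  out-targets  : ∀ {b} (g : Guarded A b) {φ k} v {a w} → (a , w) ∈ out g φ k v → w ≡ k ⊎ Image φ w
  outₛ-targets : ∀ {b} (x : Segment A b) {φ k} v {a w} → (a , w) ∈ outₛ x φ k v → w ≡ k ⊎ Image φ w

  out-targets (g ⊕ h) (inj₁ v) t = exit-or inj₁ (out-targets g v t)
  out-targets (g ⊕ h) (inj₂ v) t = exit-or inj₂ (out-targets h v t)
  out-targets (g ⊙ x) (inj₁ v) t = through inj₁ (inj₂ (entry x)) (out-targets g v t)
  out-targets (g ⊙ x) (inj₂ v) t = exit-or inj₂ (outₛ-targets x v t)

  outₛ-targets (plain τ g) (inj₁ tt) t         = exit-or inj₂ (plain-targets τ g t)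
  outₛ-targets (plain τ g) (inj₂ v)  t         = exit-or inj₂ (out-targets g v t)
  outₛ-targets (loop g) (inj₁ tt) (here refl) = inj₁ refl
  outₛ-targets (loop g) (inj₁ tt) (there t)   = through inj₂ (inj₁ tt) (init-targets g t)
  outₛ-targets (loop g) (inj₂ v)  t           = through inj₂ (inj₁ tt) (out-targets g v t)

-- Hubs of expressions embedded in a chart

module Embedding {A : Set} (C : 1-Chart A) (isHub : 1-Chart.V C → Bool) where
  open 1-Chart C using (V; start; Terminates; _—[_]→_)
  open Peeling C isHub
  open Hub

  -- The chart stays fixed while inductions descend to subexpressions by `restrict`; only `φ` and
  -- the continuation vary.
  record Embeds {X : Set} (φ : X → V) (outgoing : X → List (Label A × V)) (hub : X → Bool) : Set where
    field
      step⇒∈      : ∀ {v a w} → φ v —[ a ]→ w → (a , w) ∈ outgoing v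
      ∈⇒step      : ∀ {v a w} → (a , w) ∈ outgoing v → φ v —[ a ]→ w
      hub-agrees  : ∀ v → isHub (φ v) ≡ hub v
      ¬terminates : ∀ v → ¬ Terminates (φ v)
      injective   : Injective _≡_ _≡_ φ

  open Embeds

  restrict : ∀ {X Y φ outgoing hub} {ι : Y → X} → Injective _≡_ _≡_ ι → Embeds φ outgoing hub →
             Embeds (φ ∘ ι) (outgoing ∘ ι) (hub ∘ ι)
  restrict {ι = ι} inj E = record
    { step⇒∈      = step⇒∈ E
    ; ∈⇒step      = ∈⇒step E
    ; hub-agrees  = hub-agrees E ∘ ι
    ; ¬terminates = ¬terminates E ∘ ι
    ; injective   = inj ∘ injective E
    }

  restrictˡ : ∀ {X Y} {φ : X ⊎ Y → V} {outgoing hub} → Embeds φ outgoing hub →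
              Embeds (φ ∘ inj₁) (outgoing ∘ inj₁) (hub ∘ inj₁)
  restrictˡ = restrict inj₁-injective

  restrictʳ : ∀ {X Y} {φ : X ⊎ Y → V} {outgoing hub} → Embeds φ outgoing hub →
              Embeds (φ ∘ inj₂) (outgoing ∘ inj₂) (hub ∘ inj₂)
  restrictʳ = restrict inj₂-injective

  EmbedsGuarded : ∀ {b} (g : Guarded A b) → (Vertex g → V) → V → Set
  EmbedsGuarded g φ k = Embeds φ (out g φ k) (hub? g)

  EmbedsSegment : ∀ {b} (x : Segment A b) → (Vertexₛ x → V) → V → Set
  EmbedsSegment x φ k = Embeds φ (outₛ x φ k) (hub?ₛ x)

  nonHub⇒body : ∀ {u} a → isHub u ≡ false → entry? u a ≡ false
  nonHub⇒body one        _  = refl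
  nonHub⇒body (proper _) eq = eq

  -- A live expression has a run that ends, and this run can leave each inner loop at its hub by the
  -- 1-transition, thus avoiding entries. The first transition is kept apart because it may itself
  -- be an entry, namely when it departs from a hub.
  exits  : ∀ {b} (g : Guarded A b) {φ k} → EmbedsGuarded g φ k → b ≡ true →
           ∃₂ λ a w → (a , w) ∈ init g φ k × Star BodyStep w k
  exitsₛ : ∀ {b} (x : Segment A b) {φ k} → EmbedsSegment x φ k → b ≡ true →
           Star BodyStep (φ (entry x)) k

  exits (act a) E _ = proper a , _ , here refl , ε
  exits (_⊕_ {true} g h) E _ =
    let a , w , t , p = exits g (restrictˡ E) refl in a , w , ∈-++⁺ˡ t , p
  exits (_⊕_ {false} g h) {φ} {k} E eq =
    let a , w , t , p = exits h (restrictʳ E) eq in a , w , ∈-++⁺ʳ (init g (φ ∘ inj₁) k) t , p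
  exits (g ⊙ x) E eq =
    let a , w , t , p = exits g (restrictˡ E) refl in a , w , t , p ◅◅ exitsₛ x (restrictʳ E) eq

  exitsₛ (plain true g) E _ = (one , ∈⇒step E (here refl) , refl) ◅ ε
  exitsₛ (plain false g) E eq =
    let a , w , t , p = exits g (restrictʳ E) eq in
    (a , ∈⇒step E t , nonHub⇒body a (hub-agrees E (inj₁ tt))) ◅ p
  exitsₛ (loop g) E _ = (one , ∈⇒step E (here refl) , refl) ◅ ε

  -- The argument goes backwards from the continuation. In a loop the hub comes first, its only body
  -- step being the exit, and then the body, which continues at the hub.
  accessible  : ∀ {b} (g : Guarded A b) {φ k} → EmbedsGuarded g φ k →
                Acc (flip BodyStep) k → ∀ v → Acc (flip BodyStep) (φ v)
  accessibleₛ : ∀ {b} (x : Segment A b) {φ k} → EmbedsSegment x φ k →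
                Acc (flip BodyStep) k → ∀ v → Acc (flip BodyStep) (φ v)

  accessible (g ⊕ h) E r (inj₁ v) = accessible g (restrictˡ E) r v
  accessible (g ⊕ h) E r (inj₂ v) = accessible h (restrictʳ E) r v
  accessible (g ⊙ x) E r (inj₁ v) =
    accessible g (restrictˡ E) (accessibleₛ x (restrictʳ E) r (entry x)) v
  accessible (g ⊙ x) E r (inj₂ v) = accessibleₛ x (restrictʳ E) r v

  accessibleₛ (plain τ g) {φ} {k} E r (inj₁ tt) =
    acc λ (_ , t , _) → target (plain-targets τ g (step⇒∈ E t))
    where
    target : ∀ {w} → w ≡ k ⊎ Image (φ ∘ inj₂) w → Acc (flip BodyStep) w
    target (inj₁ refl)       = r
    target (inj₂ (v , refl)) = accessible g (restrictʳ E) r v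
  accessibleₛ (plain τ g) E r (inj₂ v) = accessible g (restrictʳ E) r v
  accessibleₛ (loop g) {φ} {k} E r = λ
    { (inj₁ tt) → hub-accessible
    ; (inj₂ v)  → accessible g (restrictʳ E) hub-accessible v }
    where
    hub-accessible : Acc (flip BodyStep) (φ (inj₁ tt))
    hub-accessible = acc λ (_ , t , e) → target (step⇒∈ E t) e
      where
      target : ∀ {a w} → (a , w) ∈ outₛ (loop g) φ k (inj₁ tt) →
               entry? (φ (inj₁ tt)) a ≡ false → Acc (flip BodyStep) w
      target (here refl) _ = r
      target (there t) e with init-proper g t
      ... | _ , refl = contradiction (trans (sym e) (hub-agrees E (inj₁ tt))) λ ()

  -- The order is that of elimination: each loop comes after those inside its body. Side by side,
  -- the order does not matter, as the images are disjoint.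
  hubs  : ∀ {b} (g : Guarded A b) {φ k} → EmbedsGuarded g φ k → List Hub
  hubsₛ : ∀ {b} (x : Segment A b) {φ k} → EmbedsSegment x φ k → List Hub
  loopHub : ∀ (g : Guarded A true) {φ k} → EmbedsSegment (loop g) φ k → Hub

  hubs nil     E = []
  hubs (act _) E = []
  hubs (g ⊕ h) E = hubs g (restrictˡ E) ++ hubs h (restrictʳ E)
  hubs (g ⊙ x) E = hubs g (restrictˡ E) ++ hubsₛ x (restrictʳ E)

  hubsₛ (plain _ g) E = hubs g (restrictʳ E)
  hubsₛ (loop g)    E = hubs g (restrictʳ E) ++ [ loopHub g E ]

  loopHub g {φ} {k} E = record
    { vertex      = h
    ; Body        = Image (φ ∘ inj₂)
    ; enters      = enters′ ∘ step⇒∈ E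
    ; closed      = λ { (v , refl) t → out-targets g v (step⇒∈ E t) }
    ; ¬terminates = λ { (v , refl) → ¬terminates E (inj₂ v) }
    ; cycle       = cycle′
    }
    where
    h : V
    h = φ (inj₁ tt)

    enters′ : ∀ {a w} → (a , w) ∈ outₛ (loop g) φ k (inj₁ tt) → entry? h a ≡ true →
              w ≡ h ⊎ Image (φ ∘ inj₂) w
    enters′ (here refl) ()
    enters′ (there t) _ = init-targets g t

    cycle′ : ∃₂ λ a w → h —[ a ]→ w × entry? h a ≡ true × Star BodyStep w h
    -- The body is live and its continuation is the hub, so a run of it that ends closes the cycle.
    cycle′ with exits g (restrictʳ E) refl
    ... | a , w , t , p with init-proper g t
    ...   | _ , refl = a , w , ∈⇒step E (there t) , hub-agrees E (inj₁ tt) , p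

  Located : Pred V 0ℓ → Hub → Set
  Located P H = P (vertex H) × (∀ {u} → Body H u → P u)

  widen : ∀ {X Y : Set} {φ : X → V} {ι : Y → X} {hs} →
          All (Located (Image (φ ∘ ι))) hs → All (Located (Image φ)) hs
  widen {ι = ι} = All.map λ ((v , eq) , body) →
    (ι v , eq) , λ b → let u , eq′ = body b in ι u , eq′

  hubs-located  : ∀ {b} (g : Guarded A b) {φ k} (E : EmbedsGuarded g φ k) →
                  All (Located (Image φ)) (hubs g E)
  hubsₛ-located : ∀ {b} (x : Segment A b) {φ k} (E : EmbedsSegment x φ k) →
                  All (Located (Image φ)) (hubsₛ x E)

  hubs-located nil     E = []
  hubs-located (act _) E = []
  hubs-located (g ⊕ h) E =
    All.++⁺ (widen (hubs-located g (restrictˡ E))) (widen (hubs-located h (restrictʳ E)))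
  hubs-located (g ⊙ x) E =
    All.++⁺ (widen (hubs-located g (restrictˡ E))) (widen (hubsₛ-located x (restrictʳ E)))

  hubsₛ-located (plain _ g) E = widen (hubs-located g (restrictʳ E))
  hubsₛ-located (loop g)    E = All.++⁺ (widen (hubs-located g (restrictʳ E)))
    (((inj₁ tt , refl) , λ (v , eq) → inj₂ v , eq) ∷ [])

  -- `Separated` only restricts bodies of earlier hubs, so for `hs′` it suffices to locate the
  -- vertices. An outer hub can therefore follow the hubs in its own body.
  separate : ∀ {P Q : Pred V 0ℓ} {hs hs′} → (∀ {u} → P u → ¬ Q u) →
             AllPairs Separated hs → All (Located P) hs →
             AllPairs Separated hs′ → All (Q ∘ vertex) hs′ → AllPairs Separated (hs ++ hs′)
  separate {P} {Q} disjoint seps located seps′ located′ =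
    AllPairs.++⁺ seps seps′ (All.map (λ (p , body) →
      All.map (λ q → (λ eq → disjoint p (subst Q eq q)) , λ b → disjoint (body b) q) located′) located)

  images-disjoint : ∀ {X Y : Set} {φ : X ⊎ Y → V} → Injective _≡_ _≡_ φ →
                    ∀ {u} → Image (φ ∘ inj₁) u → ¬ Image (φ ∘ inj₂) u
  images-disjoint inj (_ , eq) (_ , eq′) = contradiction (inj (trans eq (sym eq′))) λ ()

  hubs-separated  : ∀ {b} (g : Guarded A b) {φ k} (E : EmbedsGuarded g φ k) →
                    AllPairs Separated (hubs g E)
  hubsₛ-separated : ∀ {b} (x : Segment A b) {φ k} (E : EmbedsSegment x φ k) →
                    AllPairs Separated (hubsₛ x E)

  hubs-separated nil     E = []
  hubs-separated (act _) E = []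
  hubs-separated (g ⊕ h) E = separate (images-disjoint (injective E))
    (hubs-separated g (restrictˡ E)) (hubs-located g (restrictˡ E))
    (hubs-separated h (restrictʳ E)) (All.map proj₁ (hubs-located h (restrictʳ E)))
  hubs-separated (g ⊙ x) E = separate (images-disjoint (injective E))
    (hubs-separated g (restrictˡ E)) (hubs-located g (restrictˡ E))
    (hubsₛ-separated x (restrictʳ E)) (All.map proj₁ (hubsₛ-located x (restrictʳ E)))

  hubsₛ-separated (plain _ g) E = hubs-separated g (restrictʳ E)
  hubsₛ-separated (loop g) E = separate (λ p q → images-disjoint (injective E) q p)
    (hubs-separated g (restrictʳ E)) (hubs-located g (restrictʳ E))
    ([] ∷ []) ((tt , refl) ∷ [])

  ∈-hubVertices-++ˡ : ∀ {u hs} hs′ → u ∈ hubVertices hs → u ∈ hubVertices (hs ++ hs′)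
  ∈-hubVertices-++ˡ {u} {hs} hs′ u∈ = subst (u ∈_) (sym (map-++ vertex hs hs′)) (∈-++⁺ˡ u∈)

  ∈-hubVertices-++ʳ : ∀ {u} hs {hs′} → u ∈ hubVertices hs′ → u ∈ hubVertices (hs ++ hs′)
  ∈-hubVertices-++ʳ {u} hs {hs′} u∈ =
    subst (u ∈_) (sym (map-++ vertex hs hs′)) (∈-++⁺ʳ (hubVertices hs) u∈)

  hubs-complete  : ∀ {b} (g : Guarded A b) {φ k} (E : EmbedsGuarded g φ k) →
                   ∀ v → hub? g v ≡ true → φ v ∈ hubVertices (hubs g E)
  hubsₛ-complete : ∀ {b} (x : Segment A b) {φ k} (E : EmbedsSegment x φ k) →
                   ∀ v → hub?ₛ x v ≡ true → φ v ∈ hubVertices (hubsₛ x E)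

  hubs-complete (g ⊕ h) E (inj₁ v) e = ∈-hubVertices-++ˡ _ (hubs-complete g (restrictˡ E) v e)
  hubs-complete (g ⊕ h) E (inj₂ v) e =
    ∈-hubVertices-++ʳ (hubs g (restrictˡ E)) (hubs-complete h (restrictʳ E) v e)
  hubs-complete (g ⊙ x) E (inj₁ v) e = ∈-hubVertices-++ˡ _ (hubs-complete g (restrictˡ E) v e)
  hubs-complete (g ⊙ x) E (inj₂ v) e =
    ∈-hubVertices-++ʳ (hubs g (restrictˡ E)) (hubsₛ-complete x (restrictʳ E) v e)

  hubsₛ-complete (plain τ g) E (inj₂ v)  e = hubs-complete g (restrictʳ E) v e
  hubsₛ-complete (loop g)    E (inj₁ tt) _ = ∈-hubVertices-++ʳ (hubs g (restrictʳ E)) (here refl)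
  hubsₛ-complete (loop g)    E (inj₂ v)  e = ∈-hubVertices-++ˡ _ (hubs-complete g (restrictʳ E) v e)

  Reachable : V → Set
  Reachable = Star (Step _—[_]→_) start

  reachable-along : ∀ {u w} → Reachable u → Star BodyStep u w → Reachable w
  reachable-along r p = r ◅◅ Star.map (λ (a , t , _) → a , t) p

  reachable-step : ∀ {u a w} → Reachable u → u —[ a ]→ w → Reachable w
  reachable-step r t = r ◅◅ ((_ , t) ◅ ε)

  -- Liveness of left factors is essential here: `exits` leads through `g` to the entry of the right
  -- factor.
  reachable  : ∀ {b} (g : Guarded A b) {φ k} → EmbedsGuarded g φ k →
               (∀ {a w} → (a , w) ∈ init g φ k → Reachable w) → ∀ v → Reachable (φ v)
  reachableₛ : ∀ {b} (x : Segment A b) {φ k} → EmbedsSegment x φ k →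
               Reachable (φ (entry x)) → ∀ v → Reachable (φ v)

  reachable (g ⊕ h) E r (inj₁ v) = reachable g (restrictˡ E) (r ∘ ∈-++⁺ˡ) v
  reachable (g ⊕ h) {φ} {k} E r (inj₂ v) =
    reachable h (restrictʳ E) (r ∘ ∈-++⁺ʳ (init g (φ ∘ inj₁) k)) v
  reachable (g ⊙ x) E r (inj₁ v) = reachable g (restrictˡ E) r v
  reachable (g ⊙ x) E r (inj₂ v) =
    let _ , _ , t , p = exits g (restrictˡ E) refl in
    reachableₛ x (restrictʳ E) (reachable-along (r t) p) v

  reachableₛ (plain τ g) E r (inj₁ tt) = r
  reachableₛ (plain τ g) {k = k} E r (inj₂ v) =
    reachable g (restrictʳ E) (λ t → reachable-step r (∈⇒step E (∈-++⁺ʳ (tick τ k) t))) v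
  reachableₛ (loop g) E r (inj₁ tt) = r
  reachableₛ (loop g) E r (inj₂ v) =
    reachable g (restrictʳ E) (λ t → reachable-step r (∈⇒step E (there t))) v

-- Solutions

-- The parameter `k` is the value at the continuation. Leaving it open allows different solutions of
-- one chart.
value  : ∀ {A b} (g : Guarded A b) → StExp A → Vertex g → StExp A
valueₛ : ∀ {A b} (x : Segment A b) → StExp A → Vertexₛ x → StExp A

value (g ⊕ h) k (inj₁ v) = value g k v
value (g ⊕ h) k (inj₂ v) = value h k v
value (g ⊙ x) k (inj₁ v) = value g (⟪ x ⟫ₛ · k) v
value (g ⊙ x) k (inj₂ v) = valueₛ x k v

valueₛ x@(plain _ g) k (inj₁ tt) = ⟪ x ⟫ₛ · k
valueₛ (plain _ g)   k (inj₂ v)  = value g k v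
valueₛ x@(loop g)    k (inj₁ tt) = ⟪ x ⟫ₛ · k
valueₛ x@(loop g)    k (inj₂ v)  = value g (⟪ x ⟫ₛ · k) v

module Solution {A W : Set} (s : W → StExp A) where
  open Equational {A} ∅

  Σₛ : List (Label A × W) → StExp A
  Σₛ ts = ∑ (map (λ (a , w) → ⟦ a ⟧ · s w) ts)

  Σₛ-++ : ∀ ts us → Σₛ (ts ++ us) ≈ Σₛ ts + Σₛ us
  Σₛ-++ []             us = ≈-sym +-identityˡ
  Σₛ-++ ((a , w) ∷ ts) us = begin
    Σₛ ((a , w) ∷ ts ++ us)          ≈⟨ ∑-∷ _ (map _ (ts ++ us)) ⟩
    ⟦ a ⟧ · s w + Σₛ (ts ++ us)      ≈⟨ +-congˡ (Σₛ-++ ts us) ⟩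
    ⟦ a ⟧ · s w + (Σₛ ts + Σₛ us)    ≈⟨ ax +-assoc ⟨
    (⟦ a ⟧ · s w + Σₛ ts) + Σₛ us    ≈⟨ +-congʳ (∑-∷ _ (map _ ts)) ⟨
    Σₛ ((a , w) ∷ ts) + Σₛ us        ∎

  Σₛ-one : ∀ w ts → Σₛ ((one , w) ∷ ts) ≈ s w + Σₛ ts
  Σₛ-one w ts = ≈-trans (∑-∷ _ (map _ ts)) (+-congʳ (ax ·-identityˡ))

  Σₛ-tick : ∀ τ w → bit τ · s w ≈ Σₛ (tick τ w)
  Σₛ-tick true  w = ≈-refl
  Σₛ-tick false w = ax ·-zeroˡ

  -- Syntactic equality, so that the continuation can be rewritten inside `value` by `cong`.
  Follows : ∀ {b} (g : Guarded A b) → (Vertex g → W) → W → Set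
  Follows g φ k = ∀ v → s (φ v) ≡ value g (s k) v

  Followsₛ : ∀ {b} (x : Segment A b) → (Vertexₛ x → W) → W → Set
  Followsₛ x φ k = ∀ v → s (φ v) ≡ valueₛ x (s k) v

  follows-entry : ∀ {b} (x : Segment A b) {φ k} → Followsₛ x φ k → s (φ (entry x)) ≡ ⟪ x ⟫ₛ · s k
  follows-entry (plain _ _) eq = eq (inj₁ tt)
  follows-entry (loop _)    eq = eq (inj₁ tt)

  follows-⊙ˡ : ∀ {b} (g : Guarded A true) (x : Segment A b) {φ k} → Follows (g ⊙ x) φ k →
               Follows g (φ ∘ inj₁) (φ (inj₂ (entry x)))
  follows-⊙ˡ g x eq v =
    trans (eq (inj₁ v)) (cong (λ e → value g e v) (sym (follows-entry x (eq ∘ inj₂))))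

  follows-loop : ∀ (g : Guarded A true) {φ k} → Followsₛ (loop g) φ k →
                 Follows g (φ ∘ inj₂) (φ (inj₁ tt))
  follows-loop g eq v =
    trans (eq (inj₂ v)) (cong (λ e → value g e v) (sym (eq (inj₁ tt))))

  init-sum : ∀ {b} (g : Guarded A b) {φ k} → Follows g φ k → ⟪ g ⟫ · s k ≈ Σₛ (init g φ k)
  init-sum nil     eq = ax ·-zeroˡ
  init-sum (act a) eq = ≈-refl
  init-sum (g ⊕ h) {φ} {k} eq = begin
    (⟪ g ⟫ + ⟪ h ⟫) · s k
      ≈⟨ ax ·-distribʳ ⟩
    ⟪ g ⟫ · s k + ⟪ h ⟫ · s k
      ≈⟨ +-cong (init-sum g (eq ∘ inj₁)) (init-sum h (eq ∘ inj₂)) ⟩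
    Σₛ (init g (φ ∘ inj₁) k) + Σₛ (init h (φ ∘ inj₂) k)
      ≈⟨ Σₛ-++ (init g (φ ∘ inj₁) k) _ ⟨
    Σₛ (init (g ⊕ h) φ k) ∎
  init-sum (g ⊙ x) {φ} {k} eq = begin
    (⟪ g ⟫ · ⟪ x ⟫ₛ) · s k             ≈⟨ ax ·-assoc ⟩
    ⟪ g ⟫ · (⟪ x ⟫ₛ · s k)             ≡⟨ cong (⟪ g ⟫ ·_) (follows-entry x (eq ∘ inj₂)) ⟨
    ⟪ g ⟫ · s (φ (inj₂ (entry x)))     ≈⟨ init-sum g (follows-⊙ˡ g x eq) ⟩
    Σₛ (init (g ⊙ x) φ k)              ∎

  -- There is no termination summand: termination is delegated to the continuation by 1-transitions.
  out-sum  : ∀ {b} (g : Guarded A b) {φ k} → Follows g φ k → ∀ v → s (φ v) ≈ Σₛ (out g φ k v)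
  outₛ-sum : ∀ {b} (x : Segment A b) {φ k} → Followsₛ x φ k → ∀ v → s (φ v) ≈ Σₛ (outₛ x φ k v)

  out-sum (g ⊕ h) eq (inj₁ v) = out-sum g (eq ∘ inj₁) v
  out-sum (g ⊕ h) eq (inj₂ v) = out-sum h (eq ∘ inj₂) v
  out-sum (g ⊙ x) eq (inj₁ v) = out-sum g (follows-⊙ˡ g x eq) v
  out-sum (g ⊙ x) eq (inj₂ v) = outₛ-sum x (eq ∘ inj₂) v

  outₛ-sum (plain τ g) {φ} {k} eq (inj₁ tt) = begin
    s (φ (inj₁ tt))                              ≡⟨ eq (inj₁ tt) ⟩
    (bit τ + ⟪ g ⟫) · s k                        ≈⟨ ax ·-distribʳ ⟩
    bit τ · s k + ⟪ g ⟫ · s k                    ≈⟨ +-cong (Σₛ-tick τ k) (init-sum g (eq ∘ inj₂)) ⟩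
    Σₛ (tick τ k) + Σₛ (init g (φ ∘ inj₂) k)     ≈⟨ Σₛ-++ (tick τ k) _ ⟨
    Σₛ (tick τ k ++ init g (φ ∘ inj₂) k)         ∎
  outₛ-sum (plain τ g) eq (inj₂ v) = out-sum g (eq ∘ inj₂) v
  outₛ-sum (loop g) {φ} {k} eq (inj₁ tt) = begin
    s (φ (inj₁ tt))                          ≡⟨ eq (inj₁ tt) ⟩
    ⟪ g ⟫ ⋆ · s k                            ≈⟨ ⋆-unfold-· ⟩
    s k + ⟪ g ⟫ · (⟪ g ⟫ ⋆ · s k)            ≡⟨ cong (λ e → s k + ⟪ g ⟫ · e) (eq (inj₁ tt)) ⟨
    s k + ⟪ g ⟫ · s (φ (inj₁ tt))            ≈⟨ +-congˡ (init-sum g (follows-loop g eq)) ⟩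
    s k + Σₛ (init g (φ ∘ inj₂) (φ (inj₁ tt))) ≈⟨ Σₛ-one k (init g (φ ∘ inj₂) (φ (inj₁ tt))) ⟨
    Σₛ (outₛ (loop g) φ k (inj₁ tt))         ∎
  outₛ-sum (loop g) eq (inj₂ v) = out-sum g (follows-loop g eq) v

-- The chart of f ⋆ · x

-- Rotating a cycle by one step yields a cycle at the next vertex, where the accessibility proof is
-- smaller.
acc⇒acyclic : ∀ {X : Set} {R R′ : X → X → Set} → (∀ {u w} → R u w → R′ u w) →
              ∀ {u} → Acc (flip R′) u → ¬ TransClosure R u u
acc⇒acyclic R⊆R′ (acc rs) Plus.[ r ]    = acc⇒acyclic R⊆R′ (rs (R⊆R′ r)) Plus.[ r ]
acc⇒acyclic R⊆R′ (acc rs) (r Plus.∷ rs′) = acc⇒acyclic R⊆R′ (rs (R⊆R′ r)) (rs′ Plus.∷ʳ r)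

module IterationChart {A : Set} (f : Guarded A true) {c} (x : Segment A c) where

  W : Set
  W = Vertexₛ (loop f) ⊎ Vertexₛ x ⊎ ⊤

  pattern hub      = inj₁ (inj₁ tt)
  pattern in-f v   = inj₁ (inj₂ v)
  pattern in-x v   = inj₂ (inj₁ v)
  pattern final    = inj₂ (inj₂ tt)

  outgoing : W → List (Label A × W)
  outgoing (inj₁ v) = outₛ (loop f) inj₁ (in-x (entry x)) v
  outgoing (in-x v) = outₛ x (inj₂ ∘ inj₁) final v
  outgoing final    = []

  isHub : W → Bool
  isHub (inj₁ v) = hub?ₛ (loop f) v
  isHub (in-x v) = hub?ₛ x v
  isHub final    = false

  IsFinal : Pred W 0ℓ
  IsFinal final = ⊤
  IsFinal _     = ⊥

  isFinal? : Decidable IsFinal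
  isFinal? (inj₁ _) = no λ ()
  isFinal? (in-x _) = no λ ()
  isFinal? final    = yes tt

  chart : 1-Chart A
  chart = record
    { V           = W
    ; V-finite    = ⊎-finite (vertexₛ-finite (loop f)) (⊎-finite (vertexₛ-finite x) ⊤-finite)
    ; start       = hub
    ; _—[_]→_     = λ u a w → (a , w) ∈ outgoing u
    ; Terminates  = IsFinal
    ; terminates? = isFinal?
    }

  open Embedding chart isHub
  open Peeling chart isHub

  embeds-loop : EmbedsSegment (loop f) inj₁ (in-x (entry x))
  embeds-loop = record
    { step⇒∈ = id ; ∈⇒step = id ; hub-agrees = λ _ → refl
    ; ¬terminates = λ _ () ; injective = inj₁-injective }

  embeds-x : EmbedsSegment x (inj₂ ∘ inj₁) final
  embeds-x = record
    { step⇒∈ = id ; ∈⇒step = id ; hub-agrees = λ _ → refl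
    ; ¬terminates = λ _ () ; injective = inj₁-injective ∘ inj₂-injective }

  body-wf : WellFounded (flip BodyStep)
  body-wf = wf
    where
    wf-final : Acc (flip BodyStep) final
    wf-final = acc λ { (_ , () , _) }

    wf-x : ∀ v → Acc (flip BodyStep) (in-x v)
    wf-x = accessibleₛ x embeds-x wf-final

    wf : WellFounded (flip BodyStep)
    wf (inj₁ v) = accessibleₛ (loop f) embeds-loop (wf-x (entry x)) v
    wf (in-x v) = wf-x v
    wf final    = wf-final

  weaklyGuarded : 1-Chart.WeaklyGuarded chart
  -- Every 1-transition is a body step by the definition of `entry?`.
  weaklyGuarded (u , c) = acc⇒acyclic (λ t → one , t , refl) (body-wf u) c

  guarded-LLEE : GuardedLLEE chart
  guarded-LLEE = guardedLLEE body-wf allHubs separated complete reachable′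
    where
    allHubs : List Hub
    allHubs = hubsₛ (loop f) embeds-loop ++ hubsₛ x embeds-x

    separated : AllPairs Separated allHubs
    separated = separate {P = Image inj₁} {Q = Image (inj₂ ∘ inj₁)}
      (λ { (_ , refl) (_ , ()) })
      (hubsₛ-separated (loop f) embeds-loop) (hubsₛ-located (loop f) embeds-loop)
      (hubsₛ-separated x embeds-x) (All.map proj₁ (hubsₛ-located x embeds-x))

    complete : ∀ u → isHub u ≡ true → u ∈ hubVertices allHubs
    complete (inj₁ v) e = ∈-hubVertices-++ˡ _ (hubsₛ-complete (loop f) embeds-loop v e)
    complete (in-x v) e =
      ∈-hubVertices-++ʳ (hubsₛ (loop f) embeds-loop) (hubsₛ-complete x embeds-x v e)

    reach-x : ∀ v → Reachable (in-x v)
    reach-x = reachableₛ x embeds-x (reachable-step {u = hub} ε (here refl))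

    reachable-vertices : All (Reachable ∘ Hub.vertex) allHubs
    reachable-vertices = All.++⁺
      (All.map (λ ((v , eq) , _) → subst Reachable eq (reachableₛ (loop f) embeds-loop ε v))
               (hubsₛ-located (loop f) embeds-loop))
      (All.map (λ ((v , eq) , _) → subst Reachable eq (reach-x v)) (hubsₛ-located x embeds-x))

    reachable′ : ∀ {u} → u ∈ hubVertices allHubs → Reachable u
    reachable′ u∈ with ∈-map⁻ Hub.vertex u∈
    ... | _ , H∈ , refl = All.lookup reachable-vertices H∈

  -- The start vertex gets `e` itself instead of a starred expression, so only the equation at `hub`
  -- depends on the assumption about `e`. The values on `x` are the same for all `e`.
  solution : StExp A → W → StExp A
  solution e hub      = e
  solution e (in-f v) = value f e v
  solution e (in-x v) = valueₛ x 𝟙 v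
  solution e final    = 𝟙

  module _ {Es : List (Eq A)} where
    open Equational (_∈ Es)

    lift : ∀ {E} → Mil⁻ ⊢ E → Mil⁻ ∣ (_∈ Es) ⊢ E
    lift = translate id λ ()

    isSolution : ∀ {e} → e ≈ ⟪ f ⟫ · e + ⟪ x ⟫ₛ → IsSolution (Mil⁻ ⊞ (_∈ Es)) chart (solution e)
    isSolution {e} eq u = outgoing u , (λ _ _ → mk⇔ id id) ,
      -- Solutions require derivations without assumptions, so assumptions from `Es` become axioms.
      translate inj₁ (λ d → infer (inj₂ (axiom d)) []) (sum u)
      where
      open Solution (solution e)

      sum : ∀ u → solution e u ≈ 1-Chart.τ chart u + Σₛ (outgoing u)
      sum hub = begin
        e                                       ≈⟨ eq ⟩
        ⟪ f ⟫ · e + ⟪ x ⟫ₛ                      ≈⟨ ax +-comm ⟩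
        ⟪ x ⟫ₛ + ⟪ f ⟫ · e                      ≈⟨ +-congʳ (ax ·-identityʳ) ⟨
        ⟪ x ⟫ₛ · 𝟙 + ⟪ f ⟫ · e
          ≡⟨ cong (_+ ⟪ f ⟫ · e) (follows-entry x {φ = inj₂ ∘ inj₁} {k = final} λ _ → refl) ⟨
        solution e (in-x (entry x)) + ⟪ f ⟫ · e
          ≈⟨ +-congˡ (lift (init-sum f {φ = inj₁ ∘ inj₂} {k = hub} λ _ → refl)) ⟩
        solution e (in-x (entry x)) + Σₛ (init f (inj₁ ∘ inj₂) hub)
          ≈⟨ lift (Σₛ-one (in-x (entry x)) (init f (inj₁ ∘ inj₂) hub)) ⟨
        Σₛ (outgoing hub)                       ≈⟨ +-identityˡ ⟨
        𝟘 + Σₛ (outgoing hub)                   ∎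
      sum (in-f v) =
        ≈-trans (lift (out-sum f {φ = inj₁ ∘ inj₂} {k = hub} (λ _ → refl) v)) (≈-sym +-identityˡ)
      sum (in-x v) =
        ≈-trans (lift (outₛ-sum x {φ = inj₂ ∘ inj₁} {k = final} (λ _ → refl) v)) (≈-sym +-identityˡ)
      sum final = ≈-sym (ax +-identity)

    llee-equal : ∀ {e₁ e₂} → e₁ ≈ ⟪ f ⟫ · e₁ + ⟪ x ⟫ₛ → e₂ ≈ ⟪ f ⟫ · e₂ + ⟪ x ⟫ₛ →
                 LLEE-Equal (Mil⁻ ⊞ (_∈ Es)) e₁ e₂
    llee-equal {e₁} {e₂} eq₁ eq₂ = record
      { chart         = chart
      ; weaklyGuarded = weaklyGuarded
      ; L             = λ u → solution e₁ u ≐ solution e₂ u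
      ; solution₁     = isSolution eq₁
      ; solution₂     = isSolution eq₂
      ; start₁        = refl
      ; start₂        = refl
      } , guarded-LLEE

-- Derivation of the fixed-point rule

lemma7p4 : (A : Set) → DerivableIn (cMil {A}) RSP⋆
lemma7p4 A (rsp⋆ {e} {f} {g} f¬↓) = derive (NormalForm.normed nf-f) (NormalForm.guarded nf-f) f≈
  where
  Es : List (Eq A)
  Es = e ≐ f · e + g ∷ []

  open Equational (_∈ Es)
  open DeadExpressions (_∈ Es)
  open NormalForm

  nf-f : NormalForm f
  nf-f = nf f

  nf-g : NormalForm g
  nf-g = nf g

  f≈ : f ≈ ⟪ guarded nf-f ⟫
  f≈ = ≈-trans (translate id (λ ()) (sound nf-f)) (drop (τ nf-f) (τ⇒↓ nf-f))
    where
    drop : ∀ σ → (σ ≡ true → f ↓) → ∀ {h} → bit σ + h ≈ h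
    drop false _ = +-identityˡ
    drop true  p = contradiction (p refl) f¬↓

  x : Segment A _
  x = plain (τ nf-g) (guarded nf-g)

  premise : e ≈ f · e + g
  premise = assumption (here refl)

  conclusion-unfolds : f ⋆ · g ≈ f · (f ⋆ · g) + g
  conclusion-unfolds = ≈-trans ⋆-unfold-· (ax +-comm)

  -- Abstracting over `b` and `h` permits the split into dead and live without matching on the
  -- computed normal form of `f`.
  derive : ∀ b (h : Guarded A b) → f ≈ ⟪ h ⟫ → cMil ∣ (_∈ Es) ⊢ e ≐ f ⋆ · g
  derive false h f≈h = translate inj₁ assumption (begin
    e                    ≈⟨ premise ⟩
    f · e + g            ≈⟨ +-congʳ dead ⟩
    f + g                ≈⟨ +-congʳ dead ⟨
    f · (f ⋆ · g) + g    ≈⟨ conclusion-unfolds ⟨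
    f ⋆ · g              ∎)
    where
    dead : ∀ {k} → f · k ≈ f
    dead {k} = ≈-trans (·-congʳ f≈h) (≈-trans (dead-· h refl) (≈-sym f≈h))
  derive true h f≈h =
    -- One coinductive step with the premise as its only hypothesis: `e` solves the chart by the
    -- premise, and `f ⋆ · g` by unfolding the star.
    infer (inj₂ (1 , lCoProof refl (llee-equal (solves premise) (solves conclusion-unfolds))))
          (assumption (here refl) ∷ [])
    where
    open IterationChart h x

    solves : ∀ {k} → k ≈ f · k + g → k ≈ ⟪ h ⟫ · k + ⟪ x ⟫ₛ
    solves eq = ≈-trans eq (+-cong (·-congʳ f≈h) (translate id (λ ()) (sound nf-g)))
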